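{- Let $q\ge 2$ be a prime power and $N\ge 1$ an integer. Fix a polynomial $A\in\mathcal{M}_N$. For any integers $0\le h\le N-1$ and $1\le z\le (h+1)/2$, $$\big|\{F\in\mathcal{M}_N:\ \deg(F-A)\le h,\ P^-(F)>z\}\big|\ \le\ \frac{q^{h+1}}{z\,(1-1/q)}.$$
   Context: $\mathcal{M}_N$ is the set of monic polynomials of degree $N$ in $\mathbb{F}_q[t]$, and $P^-(F):=\min\{\deg P: P\mid F,\ P\text{ monic irreducible}\}$. The zero polynomial is regarded as having degree $\le h$ for every $h$. -}

module Defs where

open import Algebra.Bundles using (CommutativeRing)
open import Algebra.Bundles.Raw using (RawRing)
import Algebra.Definitions.RawSemiring as RawSemiringDefs
open import Algebra.Structures using (IsCommutativeRing)
open import Data.Fin.Base using (Fin)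
import Data.Integer.Base as ℤ
open import Data.List.Base using (List; []; _∷_; length; map)
import Data.List.Membership.Setoid as Membership
import Data.List.Relation.Unary.Unique.Setoid as Unique
open import Data.Nat.Base as ℕ using (ℕ; zero; suc; 2+; _≤_; _<_; _^_)
open import Data.Nat.Primality using (Prime)
open import Data.Product.Base using (∃; ∃₂; _×_)
open import Data.Rational.Unnormalised.Base as ℚ using (ℚᵘ; 1ℚᵘ)
open import Function.Bundles using (_⇔_; _↔_)
open import Level using (Level; 0ℓ; _⊔_)
open import Relation.Binary.Bundles using (Setoid)
open import Relation.Binary.PropositionalEquality
  using (_≡_; _≢_; refl; sym; trans)
open import Relation.Unary using (Pred)

private
  variable
    a ℓ p : Level

IsPrimePower : ℕ → Set
IsPrimePower q = ∃₂ λ r k → Prime r × 1 ≤ k × q ≡ r ^ k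

IsLeast : Pred ℕ p → Pred ℕ p
IsLeast S m = S m × (∀ n → S n → m ≤ n)

-- Elements are counted up to the setoid equality, so a predicate on
-- representatives is counted as a subset of the quotient.
HasCardinality : (S : Setoid a ℓ) → Pred (Setoid.Carrier S) p → ℕ → Set (a ⊔ ℓ ⊔ p)
HasCardinality S P c = ∃ λ xs → Unique xs × (∀ x → x ∈ xs ⇔ P x) × length xs ≡ c
  where
  open Unique S using (Unique)
  open Membership S using (_∈_)

record FiniteField (q : ℕ) : Set₁ where
  infixl 7 _*_
  infixl 6 _+_
  field
    Carrier           : Set
    _+_ _*_           : Carrier → Carrier → Carrier
    -_                : Carrier → Carrier
    0# 1#             : Carrier
    isCommutativeRing : IsCommutativeRing _≡_ _+_ _*_ -_ 0# 1#
    0≢1               : 0# ≢ 1#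
    inverse           : ∀ x → x ≢ 0# → ∃ λ y → x * y ≡ 1#
    enumeration       : Fin q ↔ Carrier

  commutativeRing : CommutativeRing 0ℓ 0ℓ
  commutativeRing = record { isCommutativeRing = isCommutativeRing }

module Polynomials {q : ℕ} (K : FiniteField q) where

  private module K = FiniteField K

  -- Coefficients from the constant term upwards. Trailing zeros are allowed,
  -- and _≈_ identifies lists that differ only by them.
  Poly : Set
  Poly = List K.Carrier

  coeff : Poly → ℕ → K.Carrier
  coeff []      _       = K.0#
  coeff (c ∷ _) zero    = c
  coeff (_ ∷ F) (suc n) = coeff F n

  infix 4 _≈_
  _≈_ : Poly → Poly → Set
  F ≈ G = ∀ n → coeff F n ≡ coeff G n

  polySetoid : Setoid 0ℓ 0ℓ
  polySetoid = record
    { Carrier       = Poly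
    ; _≈_           = _≈_
    ; isEquivalence = record
      { refl  = λ _ → refl
      ; sym   = λ e n → sym (e n)
      ; trans = λ e f n → trans (e n) (f n)
      }
    }

  infixl 6 _+_ _-_
  infixl 7 _*_
  infix  8 -_

  _+_ : Poly → Poly → Poly
  []      + G       = G
  (c ∷ F) + []      = c ∷ F
  (c ∷ F) + (d ∷ G) = (c K.+ d) ∷ (F + G)

  -_ : Poly → Poly
  -_ = map (λ c → K.- c)

  _-_ : Poly → Poly → Poly
  F - G = F + (- G)

  -- (c + t F) G = c G + t (F G)
  _*_ : Poly → Poly → Poly
  []      * G = []
  (c ∷ F) * G = map (c K.*_) G + (K.0# ∷ (F * G))

  polyRawRing : RawRing 0ℓ 0ℓ
  polyRawRing = record
    { Carrier = Poly
    ; _≈_     = _≈_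
    ; _+_     = _+_
    ; _*_     = _*_
    ; -_      = -_
    ; 0#      = []
    ; 1#      = K.1# ∷ []
    }

  open RawSemiringDefs (RawRing.rawSemiring polyRawRing) public
    using (_∣_; Irreducible)

  -- The zero polynomial satisfies this for every h.
  deg_≤_ : Poly → ℕ → Set
  deg F ≤ h = ∀ n → h < n → coeff F n ≡ K.0#

  -- 𝓜 N F : F is monic of degree exactly N.
  𝓜 : ℕ → Pred Poly 0ℓ
  𝓜 N F = coeff F N ≡ K.1# × deg F ≤ N

  PrimeDivisorDegree : Poly → Pred ℕ 0ℓ
  PrimeDivisorDegree F d = ∃ λ P → 𝓜 d P × Irreducible P × P ∣ F

  P⁻_≡_ : Poly → ℕ → Set
  P⁻ F ≡ m = IsLeast (PrimeDivisorDegree F) m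

  P⁻_>_ : Poly → ℕ → Set
  P⁻ F > z = ∃ λ m → (P⁻ F ≡ m) × z < m

infix 8 _·[1-1/_]
_·[1-1/_] : (z q : ℕ) .{{_ : ℕ.NonTrivial q}} → ℚᵘ
z ·[1-1/ q ] = (ℤ.+ z ℚ./ 1) ℚ.* (1ℚᵘ ℚ.- (ℤ.+ 1 ℚ./ q) {{ℕ.nonTrivial⇒nonZero q}})

instance
  ·[1-1/]-nonZero : ∀ {z q} .{{_ : ℕ.NonZero z}} .{{_ : ℕ.NonTrivial q}} →
                    ℚ.NonZero (z ·[1-1/ q ])
  ·[1-1/]-nonZero {suc _} {2+ _} = _

{-# OPTIONS --safe #-}
-- Selberg's sieve with explicit weights. Put Λ(F) = Σ λ(D) w(z − deg D), summed
-- over the monic D ∣ F with deg D ≤ z, where λ is the Liouville function. If F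
-- has no prime factor of degree ≤ z then Λ(F) = w(z), so at most w(z)⁻² Σ_F Λ(F)²
-- elements of the interval survive. Because 2z ≤ h + 1, the elements of the
-- interval are equidistributed modulo lcm(D, E), and writing |gcd(D, E)| as the
-- sum of φ(G) over the common divisors G diagonalises the second moment as
-- q^(h+1) Σ_G φ(G) (Σ_{G ∣ D} λ(D) w(z − deg D) / |D|)². As λ is completely
-- multiplicative and Σ_{D ∣ F} λ(D) counts the square roots of F, the generating
-- series of λ is (1 − q u) / (1 − q u²), and w is chosen to make every inner sum
-- equal to λ(G) q / |G|. Finally Σ_{deg G = g} φ(G) / |G|² = 1 − 1/q for g ≥ 1,
-- which gives count · (1 + s)² ≤ q^(h+2) s with s = q + z (q − 1).
module Submission where

open import Algebra.Bundles using (CommutativeRing)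
open import Algebra.Definitions.RawMagma using (_,_)
open import Algebra.Definitions.RawSemiring using (mkIrred)
import Algebra.Properties.CommutativeSemigroup as CommutativeSemigroupProperties
import Algebra.Properties.Ring as RingProperties
import Algebra.Solver.Ring.NaturalCoefficients.Default
open import Data.Empty using (⊥-elim)
import Data.Fin.Properties as Fin
open import Data.Integer.Base as ℤ using (ℤ; +_; 0ℤ; 1ℤ; -1ℤ; +≤+)
import Data.Integer.Properties as ℤ
open import Data.Integer.Tactic.RingSolver using (solve-∀)
open import Data.List.Base
  using (List; []; _∷_; _++_; length; map; foldr; filter; applyUpTo; replicate; take; drop; allFin; cartesianProductWith)
open import Data.List.Membership.Propositional using (_∈_; find; lose)
open import Data.List.Membership.Propositional.Properties
  using (∈-map⁺; ∈-++⁺ˡ; ∈-++⁺ʳ; ∈-++⁻; ∈-allFin; ∈-cartesianProductWith⁺; ∈-cartesianProductWith⁻; ∈-filter⁺; ∈-filter⁻)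
import Data.List.Membership.Setoid.Properties as SetoidMembership
open import Data.List.Properties
  using (length-++; length-map; length-applyUpTo; length-replicate; length-tabulate; length-take; length-drop;
         take++drop≡id; ++-assoc; ++-cancelʳ; ∷-injective; ≡-dec)
open import Data.List.Relation.Unary.All as All using (All; []; _∷_; all?)
import Data.List.Relation.Unary.All.Properties as All
open import Data.List.Relation.Unary.Any using (here; there; any?)
open import Data.List.Relation.Unary.Unique.Propositional using (Unique; []; _∷_)
import Data.List.Relation.Unary.Unique.Propositional.Properties as Unique
import Data.List.Relation.Unary.Unique.Setoid.Properties as SetoidUnique
open import Data.Nat.Base as ℕ using (ℕ; zero; suc; 2+; z≤n; s≤s; _≤_; _<_; _∸_; ⌊_/2⌋; NonZero; NonTrivial)
import Data.Nat.Properties as ℕ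
open import Data.Product.Base using (∃; ∃₂; _×_; _,_; proj₁; proj₂)
open import Data.Rational.Unnormalised.Base as ℚ using (_/_; _÷_; 1/_)
import Data.Rational.Unnormalised.Properties as ℚ
open import Data.Sum.Base using (_⊎_; inj₁; inj₂; map₁; reduce)
open import Function.Base using (_∘_)
open import Function.Bundles using (Injection; Inverse; mk⇔)
open import Function.Properties.Inverse using (↔⇒↣; ↔-sym)
open import Level using (0ℓ)
open import Relation.Binary.Bundles using (Setoid)
open import Relation.Binary.Definitions using (DecidableEquality; tri<; tri≈; tri>)
open import Relation.Binary.PropositionalEquality
import Relation.Binary.Reasoning.Setoid
open import Relation.Nullary using (¬_; Dec; yes; no; contradiction)
open import Relation.Nullary.Decidable using (_×-dec_; ¬?; map′; via-injection)
open import Relation.Unary using (Decidable)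
open import Defs

-- With the Möbius function in place of λ, the sum over the multiples D = G Y would carry the
-- condition that Y is coprime to G, and no weight depending on the degree alone could settle all G
-- at once. For the completely multiplicative λ that sum is λ(G) times a sum over all Y of degree at
-- most z - deg G, so one sequence w serves every G. The value λ(G) q / |G| prescribed for the inner
-- sums is not the minimiser of the diagonal form, which is proportional to μ(G) / φ(G). It is
-- chosen because both w(z) = 1 + s and the second moment q^(h+2) s then have closed forms. Their
-- quotient is at most q^(h+2) / s, and s ≥ z (q - 1) turns this into the stated bound. To keep all
-- identities in ℤ, 1 / |D| is represented by q^(z - deg D); the power of q gained in this way is
-- cancelled when the second moment is complete.

-- Finite sums of integers, indicators and Cauchy products.

module FiniteSums where
  open import Data.Integer.Base using (_+_; _*_; -_; _-_; _^_)

  private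
    variable
      A B P Q : Set

  ∑ : List A → (A → ℤ) → ℤ
  ∑ []       f = 0ℤ
  ∑ (x ∷ xs) f = f x + ∑ xs f

  ∑-cong∈ : ∀ (xs : List A) {f g} → (∀ {x} → x ∈ xs → f x ≡ g x) → ∑ xs f ≡ ∑ xs g
  ∑-cong∈ []       e = refl
  ∑-cong∈ (x ∷ xs) e = cong₂ _+_ (e (here refl)) (∑-cong∈ xs (e ∘ there))

  ∑-cong : ∀ (xs : List A) {f g} → (∀ x → f x ≡ g x) → ∑ xs f ≡ ∑ xs g
  ∑-cong xs e = ∑-cong∈ xs λ {x} _ → e x

  ∑-zero : ∀ (xs : List A) → ∑ xs (λ _ → 0ℤ) ≡ 0ℤ
  ∑-zero []       = refl
  ∑-zero (x ∷ xs) = trans (ℤ.+-identityˡ _) (∑-zero xs)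

  ∑-zero∈ : ∀ (xs : List A) {f} → (∀ {x} → x ∈ xs → f x ≡ 0ℤ) → ∑ xs f ≡ 0ℤ
  ∑-zero∈ xs e = trans (∑-cong∈ xs e) (∑-zero xs)

  ∑-+ : ∀ (xs : List A) f g → ∑ xs (λ x → f x + g x) ≡ ∑ xs f + ∑ xs g
  ∑-+ []       f g = refl
  ∑-+ (x ∷ xs) f g = trans (cong (_+_ (f x + g x)) (∑-+ xs f g)) (interchange (f x) (g x) _ _)
    where
    interchange : ∀ a b c d → (a + b) + (c + d) ≡ (a + c) + (b + d)
    interchange = solve-∀

  ∑-*ˡ : ∀ (xs : List A) c f → ∑ xs (λ x → c * f x) ≡ c * ∑ xs f
  ∑-*ˡ []       c f = sym (ℤ.*-zeroʳ c)
  ∑-*ˡ (x ∷ xs) c f = trans (cong (_+_ (c * f x)) (∑-*ˡ xs c f)) (sym (ℤ.*-distribˡ-+ c _ _))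

  ∑-*ʳ : ∀ (xs : List A) c f → ∑ xs (λ x → f x * c) ≡ ∑ xs f * c
  ∑-*ʳ xs c f = trans (∑-cong xs λ x → ℤ.*-comm (f x) c) (trans (∑-*ˡ xs c f) (ℤ.*-comm c _))

  ∑-++ : ∀ (xs ys : List A) f → ∑ (xs ++ ys) f ≡ ∑ xs f + ∑ ys f
  ∑-++ []       ys f = sym (ℤ.+-identityˡ _)
  ∑-++ (x ∷ xs) ys f = trans (cong (_+_ (f x)) (∑-++ xs ys f)) (sym (ℤ.+-assoc (f x) _ _))

  ∑-const : ∀ (xs : List A) c → ∑ xs (λ _ → c) ≡ + length xs * c
  ∑-const []       c = sym (ℤ.*-zeroˡ c)
  ∑-const (x ∷ xs) c = trans (cong (_+_ c) (∑-const xs c)) (sym (ℤ.suc-* (+ length xs) c))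

  ∑-swap : ∀ (xs : List A) (ys : List B) (f : A → B → ℤ) →
           ∑ xs (λ x → ∑ ys (f x)) ≡ ∑ ys (λ y → ∑ xs (λ x → f x y))
  ∑-swap []       ys f = sym (∑-zero ys)
  ∑-swap (x ∷ xs) ys f = trans (cong (_+_ (∑ ys (f x))) (∑-swap xs ys f)) (sym (∑-+ ys (f x) (λ y → ∑ xs (λ x → f x y))))

  ∑-square : ∀ (xs : List A) f → ∑ xs f * ∑ xs f ≡ ∑ xs (λ x → ∑ xs (λ y → f x * f y))
  ∑-square xs f = trans (sym (∑-*ʳ xs (∑ xs f) f)) (∑-cong xs λ x → sym (∑-*ˡ xs (f x) f))

  ⟦_⟧ : Dec P → ℤ
  ⟦ yes _ ⟧ = 1ℤ
  ⟦ no  _ ⟧ = 0ℤ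

  ⟦⟧-yes : (P? : Dec P) → P → ⟦ P? ⟧ ≡ 1ℤ
  ⟦⟧-yes (yes _) p = refl
  ⟦⟧-yes (no ¬p) p = contradiction p ¬p

  ⟦⟧-no : (P? : Dec P) → ¬ P → ⟦ P? ⟧ ≡ 0ℤ
  ⟦⟧-no (yes p) ¬p = contradiction p ¬p
  ⟦⟧-no (no _)  ¬p = refl

  ⟦⟧-cong : (P? : Dec P) (Q? : Dec Q) → (P → Q) → (Q → P) → ⟦ P? ⟧ ≡ ⟦ Q? ⟧
  ⟦⟧-cong (yes p) Q? f g = sym (⟦⟧-yes Q? (f p))
  ⟦⟧-cong (no ¬p) Q? f g = sym (⟦⟧-no Q? (¬p ∘ g))

  ⟦⟧-× : ∀ {R : Set} (P? : Dec P) (Q? : Dec Q) (R? : Dec R) →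
         (P → Q → R) → (R → P × Q) → ⟦ P? ⟧ * ⟦ Q? ⟧ ≡ ⟦ R? ⟧
  ⟦⟧-× (yes p) (yes q) R? f g = sym (⟦⟧-yes R? (f p q))
  ⟦⟧-× (yes p) (no ¬q) R? f g = sym (⟦⟧-no R? (¬q ∘ proj₂ ∘ g))
  ⟦⟧-× (no ¬p) Q?      R? f g = trans (ℤ.*-zeroˡ ⟦ Q? ⟧) (sym (⟦⟧-no R? (¬p ∘ proj₁ ∘ g)))

  module _ (_≟_ : DecidableEquality A) where

    ∑-delta : ∀ {xs : List A} {a} (f : A → ℤ) → Unique xs → a ∈ xs →
              ∑ xs (λ x → ⟦ x ≟ a ⟧ * f x) ≡ f a
    ∑-delta {x ∷ xs} {a} f (x∉ ∷ u) (here refl) =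
      trans (cong₂ _+_ (trans (cong (_* f a) (⟦⟧-yes (a ≟ a) refl)) (ℤ.*-identityˡ (f a)))
                       (∑-zero∈ xs λ {y} y∈ → cong (_* f y) (⟦⟧-no (y ≟ a) λ { refl → All.lookup x∉ y∈ refl })))
            (ℤ.+-identityʳ (f a))
    ∑-delta {x ∷ xs} {a} f (x∉ ∷ u) (there a∈) =
      trans (cong₂ _+_ (cong (_* f x) (⟦⟧-no (x ≟ a) λ { refl → All.lookup x∉ a∈ refl }))
                       (∑-delta f u a∈))
            (ℤ.+-identityˡ (f a))

    ∑-delta-image : ∀ {ys : List B} {e : B → A} {x} → Unique ys →
                    (∀ {y z} → y ∈ ys → z ∈ ys → e y ≡ e z → y ≡ z) →
                    ∀ {y} → y ∈ ys → x ≡ e y → ∑ ys (λ y → ⟦ x ≟ e y ⟧) ≡ 1ℤ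
    ∑-delta-image {ys = y ∷ ys} {e} (y∉ ∷ u) inj (here refl) refl =
      cong₂ _+_ (⟦⟧-yes (e y ≟ e y) refl)
        (∑-zero∈ ys λ {z} z∈ → ⟦⟧-no (e y ≟ e z)
          λ eq → All.lookup y∉ z∈ (inj (here refl) (there z∈) eq))
    ∑-delta-image {ys = z ∷ ys} {e} {x} (z∉ ∷ u) inj (there y∈) refl =
      cong₂ _+_ (⟦⟧-no (x ≟ e z) λ eq → All.lookup z∉ y∈ (inj (here refl) (there y∈) (sym eq)))
        (∑-delta-image u (λ p q → inj (there p) (there q)) y∈ refl)

    -- An x in the image is hit by exactly one y, so inserting Σ_y [x = e y] changes nothing, and
    -- after swapping the sums a delta at `e y` remains. The alternative `f x ≡ 0ℤ` admits points
    -- outside the image, as occur when f contains a divisibility indicator.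
    ∑-reindex : ∀ {xs : List A} {ys : List B} (e : B → A) (f : A → ℤ) →
                Unique xs → Unique ys →
                (∀ {y} → y ∈ ys → e y ∈ xs) →
                (∀ {y z} → y ∈ ys → z ∈ ys → e y ≡ e z → y ≡ z) →
                (∀ {x} → x ∈ xs → (∃ λ y → y ∈ ys × x ≡ e y) ⊎ f x ≡ 0ℤ) →
                ∑ xs f ≡ ∑ ys (f ∘ e)
    ∑-reindex {xs = xs} {ys} e f xs! ys! into inj onto = begin
      ∑ xs f                                          ≡⟨ ∑-cong∈ xs (λ x∈ → sym (spread (onto x∈))) ⟩
      ∑ xs (λ x → ∑ ys (λ y → ⟦ x ≟ e y ⟧ * f x))      ≡⟨ ∑-swap xs ys (λ x y → ⟦ x ≟ e y ⟧ * f x) ⟩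
      ∑ ys (λ y → ∑ xs (λ x → ⟦ x ≟ e y ⟧ * f x))      ≡⟨ ∑-cong∈ ys (λ y∈ → ∑-delta f xs! (into y∈)) ⟩
      ∑ ys (f ∘ e)                                    ∎
      where
      open ≡-Reasoning
      spread : ∀ {x} → (∃ λ y → y ∈ ys × x ≡ e y) ⊎ f x ≡ 0ℤ →
               ∑ ys (λ y → ⟦ x ≟ e y ⟧ * f x) ≡ f x
      spread {x} (inj₁ (y , y∈ , eq)) =
        trans (∑-*ʳ ys (f x) (λ y → ⟦ x ≟ e y ⟧)) (trans (cong (_* f x) (∑-delta-image ys! inj y∈ eq)) (ℤ.*-identityˡ (f x)))
      spread {x} (inj₂ fx≡0) = trans (∑-zero∈ ys λ {y} _ → trans (cong (⟦ x ≟ e y ⟧ *_) fx≡0) (ℤ.*-zeroʳ ⟦ x ≟ e y ⟧)) (sym fx≡0)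

    ∑-⊆ : ∀ {xs ys : List A} (f : A → ℤ) → Unique xs → Unique ys →
          (∀ {y} → y ∈ ys → y ∈ xs) → (∀ {x} → x ∈ xs → x ∈ ys ⊎ f x ≡ 0ℤ) →
          ∑ xs f ≡ ∑ ys f
    ∑-⊆ f xs! ys! ⊆ onto = ∑-reindex (λ x → x) f xs! ys! ⊆ (λ _ _ e → e) (λ x∈ → map₁ (λ x∈ys → _ , x∈ys , refl) (onto x∈))

  ∑-mono-filter : ∀ {P : A → Set} (P? : Decidable P) (xs : List A) {f c} →
                  (∀ x → 0ℤ ℤ.≤ f x) → (∀ {x} → x ∈ xs → P x → f x ≡ c) →
                  + length (filter P? xs) * c ℤ.≤ ∑ xs f
  ∑-mono-filter P? []       {c = c} f≥0 e = ℤ.≤-reflexive (ℤ.*-zeroˡ c)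
  ∑-mono-filter P? (x ∷ xs) {f} {c} f≥0 e with P? x
  ... | yes p = begin
    + suc (length (filter P? xs)) * c  ≡⟨ ℤ.suc-* (+ length (filter P? xs)) c ⟩
    c + + length (filter P? xs) * c    ≤⟨ ℤ.+-mono-≤ (ℤ.≤-reflexive (sym (e (here refl) p))) (∑-mono-filter P? xs f≥0 (e ∘ there)) ⟩
    f x + ∑ xs f                       ∎
    where open ℤ.≤-Reasoning
  ... | no _ = begin
    + length (filter P? xs) * c        ≤⟨ ∑-mono-filter P? xs f≥0 (e ∘ there) ⟩
    ∑ xs f                             ≡⟨ ℤ.+-identityˡ _ ⟨
    0ℤ + ∑ xs f                        ≤⟨ ℤ.+-monoˡ-≤ (∑ xs f) (f≥0 x) ⟩
    f x + ∑ xs f                       ∎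
    where open ℤ.≤-Reasoning

  -- The coefficient Σ a(k) b(n - k) of a product of power series. Shifting b, instead of
  -- subtracting indices, lets a recurrence for b be substituted under `conv` directly.
  conv : (ℕ → ℤ) → (ℕ → ℤ) → ℕ → ℤ
  conv a b zero    = a 0 * b 0
  conv a b (suc n) = conv a (b ∘ suc) n + a (suc n) * b 0

  conv-cong : ∀ a {b c} → (∀ n → b n ≡ c n) → ∀ n → conv a b n ≡ conv a c n
  conv-cong a e zero    = cong (a 0 *_) (e 0)
  conv-cong a e (suc n) = cong₂ _+_ (conv-cong a (e ∘ suc) n) (cong (a (suc n) *_) (e 0))

  conv-*ʳ : ∀ a b s n → conv a (λ k → s * b k) n ≡ s * conv a b n
  conv-*ʳ a b s zero    = shuffle (a 0) s (b 0)
    where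
    shuffle : ∀ x s y → x * (s * y) ≡ s * (x * y)
    shuffle = solve-∀
  conv-*ʳ a b s (suc n) = trans (cong (_+ a (suc n) * (s * b 0)) (conv-*ʳ a (b ∘ suc) s n))
                                (shuffle s (conv a (b ∘ suc) n) (a (suc n)) (b 0))
    where
    shuffle : ∀ s c x y → s * c + x * (s * y) ≡ s * (c + x * y)
    shuffle = solve-∀

  conv-+ʳ : ∀ a b c n → conv a (λ k → b k + c k) n ≡ conv a b n + conv a c n
  conv-+ʳ a b c zero    = ℤ.*-distribˡ-+ (a 0) (b 0) (c 0)
  conv-+ʳ a b c (suc n) = trans (cong (_+ a (suc n) * (b 0 + c 0)) (conv-+ʳ a (b ∘ suc) (c ∘ suc) n))
                                (shuffle (conv a (b ∘ suc) n) (conv a (c ∘ suc) n) (a (suc n)) (b 0) (c 0))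
    where
    shuffle : ∀ u v x y z → (u + v) + x * (y + z) ≡ (u + x * y) + (v + x * z)
    shuffle = solve-∀

  -- The series of `s ^_` is 1 / (1 - s u), and multiplying by 1 - s u gives a back. This is how a
  -- is later recovered from its convolution.
  conv-^ : ∀ a s n → conv a (s ^_) (suc n) ≡ s * conv a (s ^_) n + a (suc n)
  conv-^ a s n = cong₂ _+_ (conv-*ʳ a (s ^_) s n) (ℤ.*-identityʳ (a (suc n)))

  δ₀ : ℕ → ℤ
  δ₀ zero    = 1ℤ
  δ₀ (suc _) = 0ℤ

  conv-0 : ∀ a n → conv a (λ _ → 0ℤ) n ≡ 0ℤ
  conv-0 a zero    = ℤ.*-zeroʳ (a 0)
  conv-0 a (suc n) = cong₂ _+_ (conv-0 a n) (ℤ.*-zeroʳ (a (suc n)))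

  conv-δ₀ : ∀ a n → conv a δ₀ n ≡ a n
  conv-δ₀ a zero    = ℤ.*-identityʳ (a 0)
  conv-δ₀ a (suc n) = trans (cong₂ _+_ (conv-0 a n) (ℤ.*-identityʳ (a (suc n)))) (ℤ.+-identityˡ (a (suc n)))

open FiniteSums

length-cartesianProductWith : ∀ {A B C : Set} (f : A → B → C) xs ys →
  length (cartesianProductWith f xs ys) ≡ length xs ℕ.* length ys
length-cartesianProductWith f []       ys = refl
length-cartesianProductWith f (x ∷ xs) ys = trans (length-++ (map (f x) ys))
  (cong₂ ℕ._+_ (length-map (f x) ys) (length-cartesianProductWith f xs ys))

-- The commutative ring of polynomials on coefficient lists.

module PolynomialRing {q : ℕ} (K : FiniteField q) where
  open Polynomials K public
  module F = CommutativeRing (FiniteField.commutativeRing K)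
  module FieldProperties = RingProperties F.ring
  open CommutativeSemigroupProperties F.+-commutativeSemigroup using (interchange)

  -- Unlike _≈_, which unfolds to an equality of coefficients, the record lets
  -- both polynomials be inferred from a proof.
  infix 4 _≋_
  record _≋_ (G H : Poly) : Set where
    constructor ≈⇒≋
    field ≋⇒≈ : G ≈ H
  open _≋_ public

  ≋-refl : ∀ {G} → G ≋ G
  ≋-refl = ≈⇒≋ λ _ → refl

  ≋-sym : ∀ {G H} → G ≋ H → H ≋ G
  ≋-sym (≈⇒≋ e) = ≈⇒≋ λ n → sym (e n)

  ≋-trans : ∀ {G H J} → G ≋ H → H ≋ J → G ≋ J
  ≋-trans (≈⇒≋ e) (≈⇒≋ f) = ≈⇒≋ λ n → trans (e n) (f n)

  ≋-setoid : Setoid 0ℓ 0ℓ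
  ≋-setoid = record
    { Carrier = Poly ; _≈_ = _≋_
    ; isEquivalence = record { refl = ≋-refl ; sym = ≋-sym ; trans = ≋-trans } }

  infixl 7 _⋆_
  _⋆_ : F.Carrier → Poly → Poly
  c ⋆ G = map (c F.*_) G

  coeff-+ : ∀ G H n → coeff (G + H) n ≡ coeff G n F.+ coeff H n
  coeff-+ []      H       n       = sym (F.+-identityˡ _)
  coeff-+ (c ∷ G) []      n       = sym (F.+-identityʳ _)
  coeff-+ (c ∷ G) (d ∷ H) zero    = refl
  coeff-+ (c ∷ G) (d ∷ H) (suc n) = coeff-+ G H n

  coeff-neg : ∀ G n → coeff (- G) n ≡ F.- coeff G n
  coeff-neg []      n       = sym FieldProperties.-0#≈0#
  coeff-neg (c ∷ G) zero    = refl
  coeff-neg (c ∷ G) (suc n) = coeff-neg G n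

  coeff-⋆ : ∀ c G n → coeff (c ⋆ G) n ≡ c F.* coeff G n
  coeff-⋆ c []      n       = sym (F.zeroʳ c)
  coeff-⋆ c (d ∷ G) zero    = refl
  coeff-⋆ c (d ∷ G) (suc n) = coeff-⋆ c G n

  ∷-cong : ∀ {c d G H} → c ≡ d → G ≋ H → c ∷ G ≋ d ∷ H
  ∷-cong c≡d (≈⇒≋ e) = ≈⇒≋ λ { zero → c≡d ; (suc n) → e n }

  0∷[] : F.0# ∷ [] ≋ []
  0∷[] = ≈⇒≋ λ { zero → refl ; (suc n) → refl }

  +-cong : ∀ {G G′ H H′} → G ≋ G′ → H ≋ H′ → G + H ≋ G′ + H′
  +-cong {G} {G′} {H} {H′} (≈⇒≋ e) (≈⇒≋ f) = ≈⇒≋ λ n →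
    trans (coeff-+ G H n) (trans (cong₂ F._+_ (e n) (f n)) (sym (coeff-+ G′ H′ n)))

  neg-cong : ∀ {G G′} → G ≋ G′ → - G ≋ - G′
  neg-cong {G} {G′} (≈⇒≋ e) = ≈⇒≋ λ n → trans (coeff-neg G n) (trans (cong F.-_ (e n)) (sym (coeff-neg G′ n)))

  ⋆-cong : ∀ {c d G H} → c ≡ d → G ≋ H → c ⋆ G ≋ d ⋆ H
  ⋆-cong {c} {d} {G} {H} e (≈⇒≋ f) = ≈⇒≋ λ n →
    trans (coeff-⋆ c G n) (trans (cong₂ F._*_ e (f n)) (sym (coeff-⋆ d H n)))

  +-comm : ∀ G H → G + H ≋ H + G
  +-comm G H = ≈⇒≋ λ n → trans (coeff-+ G H n) (trans (F.+-comm _ _) (sym (coeff-+ H G n)))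

  +-assoc : ∀ G H J → (G + H) + J ≋ G + (H + J)
  +-assoc G H J = ≈⇒≋ λ n → begin
    coeff ((G + H) + J) n                          ≡⟨ coeff-+ (G + H) J n ⟩
    coeff (G + H) n F.+ coeff J n                  ≡⟨ cong (F._+ _) (coeff-+ G H n) ⟩
    (coeff G n F.+ coeff H n) F.+ coeff J n        ≡⟨ F.+-assoc _ _ _ ⟩
    coeff G n F.+ (coeff H n F.+ coeff J n)        ≡⟨ cong (coeff G n F.+_) (coeff-+ H J n) ⟨
    coeff G n F.+ coeff (H + J) n                  ≡⟨ coeff-+ G (H + J) n ⟨
    coeff (G + (H + J)) n                          ∎
    where open ≡-Reasoning

  +-identityʳ : ∀ G → G + [] ≋ G
  +-identityʳ G = ≈⇒≋ λ n → trans (coeff-+ G [] n) (F.+-identityʳ _)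

  -‿inverseʳ : ∀ G → G + (- G) ≋ []
  -‿inverseʳ G = ≈⇒≋ λ n →
    trans (coeff-+ G (- G) n) (trans (cong (coeff G n F.+_) (coeff-neg G n)) (F.-‿inverseʳ _))

  +-interchange : ∀ G H I J → (G + H) + (I + J) ≋ (G + I) + (H + J)
  +-interchange G H I J = ≈⇒≋ λ n → begin
    coeff ((G + H) + (I + J)) n              ≡⟨ four G H I J n ⟩
    _                                        ≡⟨ interchange (coeff G n) (coeff H n) (coeff I n) (coeff J n) ⟩
    _                                        ≡⟨ four G I H J n ⟨
    coeff ((G + I) + (H + J)) n              ∎
    where
    open ≡-Reasoning
    four : ∀ G H I J n → coeff ((G + H) + (I + J)) n ≡
           (coeff G n F.+ coeff H n) F.+ (coeff I n F.+ coeff J n)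
    four G H I J n = trans (coeff-+ (G + H) (I + J) n) (cong₂ F._+_ (coeff-+ G H n) (coeff-+ I J n))

  ⋆-distribˡ : ∀ c G H → c ⋆ (G + H) ≋ c ⋆ G + c ⋆ H
  ⋆-distribˡ c G H = ≈⇒≋ λ n → begin
    coeff (c ⋆ (G + H)) n                      ≡⟨ coeff-⋆ c (G + H) n ⟩
    c F.* coeff (G + H) n                      ≡⟨ cong (c F.*_) (coeff-+ G H n) ⟩
    c F.* (coeff G n F.+ coeff H n)            ≡⟨ F.distribˡ c _ _ ⟩
    c F.* coeff G n F.+ c F.* coeff H n        ≡⟨ cong₂ F._+_ (coeff-⋆ c G n) (coeff-⋆ c H n) ⟨
    coeff (c ⋆ G) n F.+ coeff (c ⋆ H) n        ≡⟨ coeff-+ (c ⋆ G) (c ⋆ H) n ⟨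
    coeff (c ⋆ G + c ⋆ H) n                    ∎
    where open ≡-Reasoning

  ⋆-⋆ : ∀ c d G → c ⋆ (d ⋆ G) ≋ (c F.* d) ⋆ G
  ⋆-⋆ c d G = ≈⇒≋ λ n → begin
    coeff (c ⋆ (d ⋆ G)) n       ≡⟨ coeff-⋆ c (d ⋆ G) n ⟩
    c F.* coeff (d ⋆ G) n       ≡⟨ cong (c F.*_) (coeff-⋆ d G n) ⟩
    c F.* (d F.* coeff G n)     ≡⟨ F.*-assoc c d _ ⟨
    (c F.* d) F.* coeff G n     ≡⟨ coeff-⋆ (c F.* d) G n ⟨
    coeff ((c F.* d) ⋆ G) n     ∎
    where open ≡-Reasoning

  1⋆ : ∀ G → F.1# ⋆ G ≋ G
  1⋆ G = ≈⇒≋ λ n → trans (coeff-⋆ F.1# G n) (F.*-identityˡ _)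

  *-congˡ : ∀ G {H H′} → H ≋ H′ → G * H ≋ G * H′
  *-congˡ []      e = ≋-refl
  *-congˡ (c ∷ G) {H} {H′} e = +-cong {c ⋆ H} {c ⋆ H′} (⋆-cong {H = H′} refl e) (∷-cong refl (*-congˡ G e))

  *-zeroʳ : ∀ G → G * [] ≋ []
  *-zeroʳ []      = ≋-refl
  *-zeroʳ (c ∷ G) = ≋-trans {_} {F.0# ∷ []} (∷-cong refl (*-zeroʳ G)) 0∷[]

  -- The mirror image of the defining recursion of `_*_`. Commutativity follows by induction, and
  -- then the laws in one argument transfer to the other.
  *-∷ʳ : ∀ G d H → G * (d ∷ H) ≋ d ⋆ G + (F.0# ∷ (G * H))
  *-∷ʳ []      d H = ≋-sym 0∷[]
  *-∷ʳ (c ∷ G) d H = ∷-cong (cong (F._+ F.0#) (F.*-comm c d)) (begin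
    c ⋆ H + G * (d ∷ H)                       ≈⟨ +-cong {c ⋆ H} ≋-refl (*-∷ʳ G d H) ⟩
    c ⋆ H + (d ⋆ G + (F.0# ∷ (G * H)))        ≈⟨ +-assoc (c ⋆ H) (d ⋆ G) _ ⟨
    (c ⋆ H + d ⋆ G) + (F.0# ∷ (G * H))        ≈⟨ +-cong (+-comm (c ⋆ H) (d ⋆ G)) ≋-refl ⟩
    (d ⋆ G + c ⋆ H) + (F.0# ∷ (G * H))        ≈⟨ +-assoc (d ⋆ G) (c ⋆ H) _ ⟩
    d ⋆ G + (c ⋆ H + (F.0# ∷ (G * H)))        ∎)
    where open import Relation.Binary.Reasoning.Setoid ≋-setoid

  *-comm : ∀ G H → G * H ≋ H * G
  *-comm []      H = ≋-sym (*-zeroʳ H)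
  *-comm (c ∷ G) H = ≋-trans {_} {c ⋆ H + (F.0# ∷ (H * G))}
    (+-cong {c ⋆ H} ≋-refl (∷-cong refl (*-comm G H))) (≋-sym (*-∷ʳ H c G))

  *-cong : ∀ {G G′ H H′} → G ≋ G′ → H ≋ H′ → G * H ≋ G′ * H′
  *-cong {G} {G′} {H} {H′} e f = begin
    G * H    ≈⟨ *-congˡ G f ⟩
    G * H′   ≈⟨ *-comm G H′ ⟩
    H′ * G   ≈⟨ *-congˡ H′ e ⟩
    H′ * G′  ≈⟨ *-comm H′ G′ ⟩
    G′ * H′  ∎
    where open import Relation.Binary.Reasoning.Setoid ≋-setoid

  *-distribˡ : ∀ G H J → G * (H + J) ≋ G * H + G * J
  *-distribˡ []      H J = ≋-refl
  *-distribˡ (c ∷ G) H J = begin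
    c ⋆ (H + J) + (F.0# ∷ (G * (H + J)))
      ≈⟨ +-cong (⋆-distribˡ c H J) (∷-cong (sym (F.+-identityˡ F.0#)) (*-distribˡ G H J)) ⟩
    (c ⋆ H + c ⋆ J) + ((F.0# ∷ (G * H)) + (F.0# ∷ (G * J)))
      ≈⟨ +-interchange (c ⋆ H) (c ⋆ J) _ _ ⟩
    (c ⋆ H + (F.0# ∷ (G * H))) + (c ⋆ J + (F.0# ∷ (G * J))) ∎
    where open import Relation.Binary.Reasoning.Setoid ≋-setoid

  *-distribʳ : ∀ J G H → (G + H) * J ≋ G * J + H * J
  *-distribʳ J G H = begin
    (G + H) * J      ≈⟨ *-comm (G + H) J ⟩
    J * (G + H)      ≈⟨ *-distribˡ J G H ⟩
    J * G + J * H    ≈⟨ +-cong (*-comm J G) (*-comm J H) ⟩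
    G * J + H * J    ∎
    where open import Relation.Binary.Reasoning.Setoid ≋-setoid

  ⋆-* : ∀ c G H → (c ⋆ G) * H ≋ c ⋆ (G * H)
  ⋆-* c []      H = ≋-refl
  ⋆-* c (d ∷ G) H = begin
    (c F.* d) ⋆ H + (F.0# ∷ ((c ⋆ G) * H))
      ≈⟨ +-cong (≋-sym (⋆-⋆ c d H)) (∷-cong (sym (F.zeroʳ c)) (⋆-* c G H)) ⟩
    c ⋆ (d ⋆ H) + c ⋆ (F.0# ∷ (G * H))
      ≈⟨ ⋆-distribˡ c (d ⋆ H) _ ⟨
    c ⋆ (d ⋆ H + (F.0# ∷ (G * H))) ∎
    where open import Relation.Binary.Reasoning.Setoid ≋-setoid

  0∷-* : ∀ G H → (F.0# ∷ G) * H ≋ F.0# ∷ (G * H)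
  0∷-* G H = ≈⇒≋ λ n → trans (coeff-+ (F.0# ⋆ H) _ n)
    (trans (cong (F._+ coeff (F.0# ∷ (G * H)) n) (trans (coeff-⋆ F.0# H n) (F.zeroˡ _))) (F.+-identityˡ _))

  *-assoc : ∀ G H J → (G * H) * J ≋ G * (H * J)
  *-assoc []      H J = ≋-refl
  *-assoc (c ∷ G) H J = begin
    (c ⋆ H + (F.0# ∷ (G * H))) * J          ≈⟨ *-distribʳ J (c ⋆ H) _ ⟩
    (c ⋆ H) * J + (F.0# ∷ (G * H)) * J      ≈⟨ +-cong (⋆-* c H J) (0∷-* (G * H) J) ⟩
    c ⋆ (H * J) + (F.0# ∷ ((G * H) * J))    ≈⟨ +-cong {c ⋆ (H * J)} ≋-refl (∷-cong refl (*-assoc G H J)) ⟩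
    c ⋆ (H * J) + (F.0# ∷ (G * (H * J)))    ∎
    where open import Relation.Binary.Reasoning.Setoid ≋-setoid

  *-identityˡ : ∀ G → (F.1# ∷ []) * G ≋ G
  *-identityˡ G = ≈⇒≋ λ n → trans (coeff-+ (F.1# ⋆ G) _ n)
    (trans (cong₂ F._+_ (≋⇒≈ (1⋆ G) n) (≋⇒≈ 0∷[] n)) (F.+-identityʳ _))

  polyRing : CommutativeRing 0ℓ 0ℓ
  polyRing = record
    { Carrier = Poly ; _≈_ = _≋_ ; _+_ = _+_ ; _*_ = _*_ ; -_ = -_ ; 0# = [] ; 1# = F.1# ∷ []
    ; isCommutativeRing = record
      { isRing = record
        { +-isAbelianGroup = record
          { isGroup = record
            { isMonoid = record
              { isSemigroup = record
                { isMagma = record { isEquivalence = Setoid.isEquivalence ≋-setoid ; ∙-cong = +-cong }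
                ; assoc = +-assoc }
              ; identity = (λ G → ≋-refl) , +-identityʳ }
            ; inverse = (λ G → ≋-trans (+-comm (- G) G) (-‿inverseʳ G)) , -‿inverseʳ
            ; ⁻¹-cong = neg-cong }
          ; comm = +-comm }
        ; *-cong = *-cong
        ; *-assoc = *-assoc
        ; *-identity = *-identityˡ , λ G → ≋-trans (*-comm G _) (*-identityˡ G)
        ; distrib = *-distribˡ , *-distribʳ }
      ; *-comm = *-comm } }

  module PolyProperties = RingProperties (CommutativeRing.ring polyRing)

  open Algebra.Solver.Ring.NaturalCoefficients.Default (CommutativeRing.commutativeSemiring polyRing) public
    using (solve; _:=_; _:+_; _:*_)

-- Monic polynomials: division, Bézout, gcd and lcm, translation by residues.

module Monics {q : ℕ} (K : FiniteField q) where
  open PolynomialRing K public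
  open FiniteField K using (0≢1; inverse; enumeration)
  private
    module ≋-Reasoning where
      open import Relation.Binary.Reasoning.Setoid ≋-setoid public

  infix 4 _≟ᴷ_
  _≟ᴷ_ : DecidableEquality F.Carrier
  _≟ᴷ_ = via-injection (↔⇒↣ (↔-sym enumeration)) Fin._≟_

  -- The list f encodes the monic polynomial of degree length f whose lower
  -- coefficients are f, so that each monic polynomial has a unique code.
  Monic : Set
  Monic = List F.Carrier

  poly : Monic → Poly
  poly f = f ++ F.1# ∷ []

  infix 4 _≟ᴹ_
  _≟ᴹ_ : DecidableEquality Monic
  _≟ᴹ_ = ≡-dec _≟ᴷ_

  𝓜-resp : ∀ {n G H} → G ≋ H → 𝓜 n G → 𝓜 n H
  𝓜-resp (≈⇒≋ e) (lead , high) = trans (sym (e _)) lead , λ k n<k → trans (sym (e k)) (high k n<k)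

  𝓜-poly : ∀ f → 𝓜 (length f) (poly f)
  𝓜-poly []      = refl , λ { (suc k) _ → refl }
  𝓜-poly (c ∷ f) = proj₁ (𝓜-poly f) , λ { (suc k) (s≤s l<k) → proj₂ (𝓜-poly f) k l<k }

  coeff-applyUpTo : ∀ (a : ℕ → F.Carrier) n → a n ≡ F.1# → (∀ k → n < k → a k ≡ F.0#) →
                    ∀ k → coeff (poly (applyUpTo a n)) k ≡ a k
  coeff-applyUpTo a zero    lead high zero    = sym lead
  coeff-applyUpTo a zero    lead high (suc k) = sym (high (suc k) (s≤s z≤n))
  coeff-applyUpTo a (suc n) lead high zero    = refl
  coeff-applyUpTo a (suc n) lead high (suc k) =
    coeff-applyUpTo (λ i → a (suc i)) n lead (λ i n<i → high (suc i) (s≤s n<i)) k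

  code : ℕ → Poly → Monic
  code n G = applyUpTo (coeff G) n

  poly-code : ∀ {n G} → 𝓜 n G → poly (code n G) ≋ G
  poly-code {n} {G} (lead , high) = ≈⇒≋ (coeff-applyUpTo (coeff G) n lead high)

  length-code : ∀ n G → length (code n G) ≡ n
  length-code n G = length-applyUpTo (coeff G) n

  poly≉0 : ∀ f → ¬ poly f ≋ []
  poly≉0 f (≈⇒≋ e) = 0≢1 (trans (sym (e (length f))) (proj₁ (𝓜-poly f)))

  ∷-injective-≋ : ∀ {c d G H} → c ∷ G ≋ d ∷ H → c ≡ d × G ≋ H
  ∷-injective-≋ (≈⇒≋ e) = e 0 , ≈⇒≋ λ n → e (suc n)

  poly-injective : ∀ {f g} → poly f ≋ poly g → f ≡ g
  poly-injective {[]}    {[]}    e = refl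
  poly-injective {[]}    {d ∷ g} e = contradiction (≋-sym (proj₂ (∷-injective-≋ e))) (poly≉0 g)
  poly-injective {c ∷ f} {[]}    e = contradiction (proj₂ (∷-injective-≋ e)) (poly≉0 f)
  poly-injective {c ∷ f} {d ∷ g} e =
    cong₂ _∷_ (proj₁ (∷-injective-≋ e)) (poly-injective (proj₂ (∷-injective-≋ e)))

  𝓜-* : ∀ f {n G} → 𝓜 n G → 𝓜 (length f ℕ.+ n) (poly f * G)
  𝓜-* []      {n} {G} m = 𝓜-resp (≋-sym (*-identityˡ G)) m
  𝓜-* (c ∷ f) {n} {G} (leadG , highG) = lead′ , high′
    where
    rec = 𝓜-* f {n} {G} (leadG , highG)
    -- Above degree n the summand `c ⋆ G` vanishes, so only the shifted product contributes to the
    -- top coefficients.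
    split : ∀ k → n < suc k → coeff (poly (c ∷ f) * G) (suc k) ≡ coeff (poly f * G) k
    split k n<k = begin
      coeff (c ⋆ G + (F.0# ∷ (poly f * G))) (suc k)
        ≡⟨ coeff-+ (c ⋆ G) _ (suc k) ⟩
      coeff (c ⋆ G) (suc k) F.+ coeff (poly f * G) k
        ≡⟨ cong (F._+ coeff (poly f * G) k) (trans (coeff-⋆ c G (suc k)) (trans (cong (c F.*_) (highG (suc k) n<k)) (F.zeroʳ c))) ⟩
      F.0# F.+ coeff (poly f * G) k
        ≡⟨ F.+-identityˡ _ ⟩
      coeff (poly f * G) k ∎
      where open ≡-Reasoning
    lead′ = trans (split (length f ℕ.+ n) (s≤s (ℕ.m≤n+m n (length f)))) (proj₁ rec)
    high′ : ∀ k → suc (length f ℕ.+ n) < k → coeff (poly (c ∷ f) * G) k ≡ F.0#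
    high′ (suc k) (s≤s l<k) =
      trans (split k (ℕ.m<n⇒m<1+n (ℕ.≤-<-trans (ℕ.m≤n+m n (length f)) l<k))) (proj₂ rec k l<k)

  infixl 7 _·_
  abstract
    -- Kept abstract: beyond this block a product is known only through its polynomial and its
    -- degree.
    _·_ : Monic → Monic → Monic
    f · g = code (length f ℕ.+ length g) (poly f * poly g)

    poly-· : ∀ f g → poly (f · g) ≋ poly f * poly g
    poly-· f g = poly-code (𝓜-* f (𝓜-poly g))

    length-· : ∀ f g → length (f · g) ≡ length f ℕ.+ length g
    length-· f g = length-code (length f ℕ.+ length g) (poly f * poly g)

  ·-comm : ∀ f g → f · g ≡ g · f
  ·-comm f g = poly-injective (≋-trans (poly-· f g) (≋-trans (*-comm (poly f) (poly g)) (≋-sym (poly-· g f))))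

  ·-assoc : ∀ f g h → (f · g) · h ≡ f · (g · h)
  ·-assoc f g h = poly-injective (begin
    poly ((f · g) · h)        ≈⟨ poly-· (f · g) h ⟩
    poly (f · g) * poly h     ≈⟨ *-cong (poly-· f g) ≋-refl ⟩
    poly f * poly g * poly h  ≈⟨ *-assoc (poly f) (poly g) (poly h) ⟩
    poly f * (poly g * poly h) ≈⟨ *-congˡ (poly f) (poly-· g h) ⟨
    poly f * poly (g · h)     ≈⟨ poly-· f (g · h) ⟨
    poly (f · (g · h))        ∎)
    where open ≋-Reasoning

  ·-identityˡ : ∀ f → [] · f ≡ f
  ·-identityˡ f = poly-injective (≋-trans (poly-· [] f) (*-identityˡ _))

  ·-identityʳ : ∀ f → f · [] ≡ f
  ·-identityʳ f = trans (·-comm f []) (·-identityˡ f)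

  -- Trailing zeros make the length of a list a mere bound for the degree, so the leading
  -- coefficient is searched for from the top. The bound `length f < length G` is what makes the
  -- Euclidean algorithm terminate.
  normalise : ∀ G → G ≋ [] ⊎ ∃₂ λ c f → c ≢ F.0# × G ≋ c ⋆ poly f × length f < length G
  normalise []      = inj₁ ≋-refl
  normalise (c ∷ G) with normalise G
  ... | inj₂ (d , f , d≢0 , e , l<) = inj₂ (d , d⁻¹ F.* c ∷ f , d≢0 , ∷-cong lead e , s≤s l<)
    where
    d⁻¹ = proj₁ (inverse d d≢0)
    lead : c ≡ d F.* (d⁻¹ F.* c)
    lead = sym (trans (sym (F.*-assoc d d⁻¹ c)) (trans (cong (F._* c) (proj₂ (inverse d d≢0))) (F.*-identityˡ c)))
  ... | inj₁ G≋0 with c ≟ᴷ F.0#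
  ...   | yes refl = inj₁ (≋-trans (∷-cong refl G≋0) 0∷[])
  ...   | no c≢0   = inj₂ (c , [] , c≢0 , ∷-cong (sym (F.*-identityʳ c)) G≋0 , s≤s z≤n)

  coeff-length : ∀ G {n} → length G ≤ n → coeff G n ≡ F.0#
  coeff-length []      _         = refl
  coeff-length (c ∷ G) (s≤s l≤n) = coeff-length G l≤n

  *-⋆ : ∀ c G H → G * (c ⋆ H) ≋ c ⋆ (G * H)
  *-⋆ c G H = ≋-trans (*-comm G _) (≋-trans (⋆-* c H G) (⋆-cong refl (*-comm H G)))

  -- If Y had leading coefficient c ≠ 0, then so would the product, as `poly f` is monic. That
  -- coefficient sits in a degree at least `length f`, where R has none.
  poly*-degree : ∀ f {Y R} → poly f * Y ≋ R → length R ≤ length f → Y ≋ []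
  poly*-degree f {Y} {R} e R≤f with normalise Y
  ... | inj₁ Y≋0 = Y≋0
  ... | inj₂ (c , g , c≢0 , Y≋ , _) = contradiction c≡0 c≢0
    where
    k = length f ℕ.+ length g
    open ≡-Reasoning
    c≡0 : c ≡ F.0#
    c≡0 = begin
      c                                ≡⟨ F.*-identityʳ c ⟨
      c F.* F.1#                       ≡⟨ cong (c F.*_) (proj₁ (𝓜-* f (𝓜-poly g))) ⟨
      c F.* coeff (poly f * poly g) k  ≡⟨ coeff-⋆ c (poly f * poly g) k ⟨
      coeff (c ⋆ (poly f * poly g)) k  ≡⟨ ≋⇒≈ (*-⋆ c (poly f) (poly g)) k ⟨
      coeff (poly f * (c ⋆ poly g)) k  ≡⟨ ≋⇒≈ (*-congˡ (poly f) Y≋) k ⟨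
      coeff (poly f * Y) k             ≡⟨ ≋⇒≈ e k ⟩
      coeff R k                        ≡⟨ coeff-length R (ℕ.≤-trans R≤f (ℕ.m≤m+n _ _)) ⟩
      F.0#                             ∎

  poly*-cancel : ∀ f {G H} → poly f * G ≋ poly f * H → G ≋ H
  poly*-cancel f {G} {H} e = PolyProperties.x∙y⁻¹≈ε⇒x≈y G H (poly*-degree f {R = []} (begin
    poly f * (G + (- H))             ≈⟨ *-distribˡ (poly f) G (- H) ⟩
    poly f * G + poly f * (- H)      ≈⟨ +-cong ≋-refl (PolyProperties.-‿distribʳ-* (poly f) H) ⟨
    poly f * G + (- (poly f * H))    ≈⟨ +-cong e ≋-refl ⟩
    poly f * H + (- (poly f * H))    ≈⟨ -‿inverseʳ (poly f * H) ⟩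
    []                               ∎) z≤n)
    where open ≋-Reasoning

  ·-cancelˡ : ∀ f {g h} → f · g ≡ f · h → g ≡ h
  ·-cancelˡ f {g} {h} e = poly-injective (poly*-cancel f (begin
    poly f * poly g  ≈⟨ poly-· f g ⟨
    poly (f · g)     ≡⟨ cong poly e ⟩
    poly (f · h)     ≈⟨ poly-· f h ⟩
    poly f * poly h  ∎))
    where open ≋-Reasoning

  -- One step of long division: e is the top entry of X, and subtracting e times the monic divisor
  -- shortens X by one.
  split-top : ∀ f X → length X ≡ suc (length f) →
              ∃₂ λ e R → X ≋ e ⋆ poly f + R × length R ≡ length f
  split-top []      (x ∷ []) _ = x , [] , ∷-cong (sym (F.*-identityʳ x)) ≋-refl , refl
  split-top (a ∷ f) (x ∷ X)  l with split-top f X (ℕ.suc-injective l)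
  ... | e , R , X≋ , lR = e , (F.- (e F.* a) F.+ x) ∷ R , ∷-cong lead X≋ , cong suc lR
    where
    lead : x ≡ e F.* a F.+ (F.- (e F.* a) F.+ x)
    lead = sym (trans (sym (F.+-assoc _ _ x)) (trans (cong (F._+ x) (F.-‿inverseʳ _)) (F.+-identityˡ x)))

  -- As in Horner's scheme, the division of c + t G continues from the remainder of G. Remainders
  -- are padded to length exactly `length f`, so the residues modulo f are the words of that length.
  divMod : ∀ f G → ∃₂ λ Q R → G ≋ poly f * Q + R × length R ≡ length f
  divMod f []      = [] , replicate (length f) F.0# ,
    ≋-sym (≋-trans (+-cong (*-zeroʳ (poly f)) (zeros (length f))) ≋-refl) , length-replicate (length f)
    where
    zeros : ∀ n → replicate n F.0# ≋ []
    zeros zero    = ≋-refl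
    zeros (suc n) = ≋-trans (∷-cong refl (zeros n)) 0∷[]
  divMod f (c ∷ G) with divMod f G
  ... | Q , R , G≋ , lR with split-top f (c ∷ R) (cong suc lR)
  ...   | e , R′ , cR≋ , lR′ = e ∷ Q , R′ , (begin
    c ∷ G                                            ≈⟨ ∷-cong (sym (F.+-identityˡ c)) G≋ ⟩
    (F.0# ∷ (poly f * Q)) + (c ∷ R)                  ≈⟨ +-cong {F.0# ∷ (poly f * Q)} ≋-refl cR≋ ⟩
    (F.0# ∷ (poly f * Q)) + (e ⋆ poly f + R′)        ≈⟨ +-assoc _ (e ⋆ poly f) R′ ⟨
    ((F.0# ∷ (poly f * Q)) + e ⋆ poly f) + R′        ≈⟨ +-cong (+-comm _ (e ⋆ poly f)) ≋-refl ⟩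
    (e ⋆ poly f + (F.0# ∷ (poly f * Q))) + R′        ≈⟨ +-cong (*-∷ʳ (poly f) e Q) ≋-refl ⟨
    poly f * (e ∷ Q) + R′                            ∎) , lR′
    where open ≋-Reasoning

  divMod-unique : ∀ f {Q R Q′ R′} → poly f * Q + R ≋ poly f * Q′ + R′ →
                  length R ≤ length f → length R′ ≤ length f → R ≋ R′
  divMod-unique f {Q} {R} {Q′} {R′} e lR lR′ = ≋-sym (PolyProperties.x∙y⁻¹≈ε⇒x≈y R′ R (begin
    R′ + (- R)                   ≈⟨ diff ⟨
    poly f * (Q + (- Q′))        ≈⟨ *-congˡ (poly f) (poly*-degree f diff bound) ⟩
    poly f * []                  ≈⟨ *-zeroʳ (poly f) ⟩
    []                           ∎))
    where
    open ≋-Reasoning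
    bound : length (R′ + (- R)) ≤ length f
    bound = length-+ R′ (- R) lR′ (subst (_≤ length f) (sym (length-map _ R)) lR)
      where
      length-+ : ∀ G H {n} → length G ≤ n → length H ≤ n → length (G + H) ≤ n
      length-+ []      H       _       h       = h
      length-+ (c ∷ G) []      g       _       = g
      length-+ (c ∷ G) (d ∷ H) (s≤s g) (s≤s h) = s≤s (length-+ G H g h)
    a = poly f * Q
    b = poly f * Q′
    diff : poly f * (Q + (- Q′)) ≋ R′ + (- R)
    diff = begin
      poly f * (Q + (- Q′))                        ≈⟨ *-distribˡ (poly f) Q (- Q′) ⟩
      a + poly f * (- Q′)                          ≈⟨ +-cong ≋-refl (PolyProperties.-‿distribʳ-* (poly f) Q′) ⟨
      a + (- b)                                    ≈⟨ +-identityʳ _ ⟨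
      (a + (- b)) + []                             ≈⟨ +-cong ≋-refl (-‿inverseʳ R) ⟨
      (a + (- b)) + (R + (- R))                    ≈⟨ +-interchange a (- b) R (- R) ⟩
      (a + R) + ((- b) + (- R))                    ≈⟨ +-cong e ≋-refl ⟩
      (b + R′) + ((- b) + (- R))                   ≈⟨ +-interchange b R′ (- b) (- R) ⟩
      (b + (- b)) + (R′ + (- R))                   ≈⟨ +-cong (-‿inverseʳ b) ≋-refl ⟩
      R′ + (- R)                                   ∎

  infix 4 _∣ᴾ_ _∣ᴹ_ _∣ᴾ?_ _∣ᴹ?_
  -- Two forms of divisibility: an arbitrary cofactor suits linear combinations, a monic cofactor
  -- suits counting. They agree on monic polynomials.
  _∣ᴾ_ : Monic → Poly → Set
  f ∣ᴾ G = ∃ λ Q → poly f * Q ≋ G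

  _∣ᴹ_ : Monic → Monic → Set
  f ∣ᴹ g = ∃ λ h → f · h ≡ g

  _∣ᴾ?_ : ∀ f G → Dec (f ∣ᴾ G)
  f ∣ᴾ? G with divMod f G
  ... | Q , R , G≋ , lR with normalise R
  ...   | inj₁ R≋0 = yes (Q , ≋-sym (≋-trans G≋ (≋-trans (+-cong ≋-refl R≋0) (+-identityʳ _))))
  ...   | inj₂ (c , g , c≢0 , R≋ , _) = no λ { (Q′ , e) → poly≉0 g (begin
    poly g                              ≈⟨ 1⋆ (poly g) ⟨
    F.1# ⋆ poly g                       ≈⟨ ⋆-cong (trans (F.*-comm _ c) (proj₂ (inverse c c≢0))) ≋-refl ⟨
    (proj₁ (inverse c c≢0) F.* c) ⋆ poly g ≈⟨ ⋆-⋆ _ c (poly g) ⟨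
    proj₁ (inverse c c≢0) ⋆ (c ⋆ poly g)   ≈⟨ ⋆-cong refl R≋ ⟨
    proj₁ (inverse c c≢0) ⋆ R              ≈⟨ ⋆-cong refl (divMod-unique f (≋-trans (+-identityʳ _) (≋-trans e G≋)) z≤n (ℕ.≤-reflexive lR)) ⟨
    []                                  ∎) }
    where open ≋-Reasoning

  ∣ᴹ⇒∣ᴾ : ∀ {f g} → f ∣ᴹ g → f ∣ᴾ poly g
  ∣ᴹ⇒∣ᴾ {f} (h , refl) = poly h , ≋-sym (poly-· f h)

  -- The cofactor is c times a monic polynomial, and comparing leading coefficients gives c = 1. The
  -- degrees of the two sides are not known to agree beforehand; if they differed, either c = 0 or 0
  -- = 1 would follow.
  ∣ᴾ⇒∣ᴹ : ∀ {f g} → f ∣ᴾ poly g → f ∣ᴹ g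
  ∣ᴾ⇒∣ᴹ {f} {g} (Q , e) with normalise Q
  ... | inj₁ Q≋0 = contradiction (≋-trans (≋-sym e) (≋-trans (*-congˡ (poly f) Q≋0) (*-zeroʳ (poly f)))) (poly≉0 g)
  ... | inj₂ (c , h , c≢0 , Q≋ , _) = h , poly-injective (begin
    poly (f · h)          ≈⟨ 1⋆ _ ⟨
    F.1# ⋆ poly (f · h)   ≈⟨ ⋆-cong c≡1 ≋-refl ⟨
    c ⋆ poly (f · h)      ≈⟨ scaled ⟩
    poly g                ∎)
    where
    open ≋-Reasoning
    scaled : c ⋆ poly (f · h) ≋ poly g
    scaled = begin
      c ⋆ poly (f · h)      ≈⟨ ⋆-cong refl (poly-· f h) ⟩
      c ⋆ (poly f * poly h) ≈⟨ *-⋆ c (poly f) (poly h) ⟨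
      poly f * (c ⋆ poly h) ≈⟨ *-congˡ (poly f) Q≋ ⟨
      poly f * Q            ≈⟨ e ⟩
      poly g                ∎
    m = length (f · h)
    coeffs : ∀ k → c F.* coeff (poly (f · h)) k ≡ coeff (poly g) k
    coeffs k = trans (sym (coeff-⋆ c (poly (f · h)) k)) (≋⇒≈ scaled k)
    c≡ : c ≡ coeff (poly g) m
    c≡ = trans (sym (F.*-identityʳ c)) (trans (cong (c F.*_) (sym (proj₁ (𝓜-poly (f · h))))) (coeffs m))
    c≡1 : c ≡ F.1#
    c≡1 with ℕ.<-cmp m (length g)
    ... | tri≈ _ m≡ _ = trans c≡ (trans (cong (coeff (poly g)) m≡) (proj₁ (𝓜-poly g)))
    ... | tri> _ _ g<m = contradiction (trans c≡ (proj₂ (𝓜-poly g) m g<m)) c≢0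
    ... | tri< m<g _ _ = ⊥-elim (0≢1 (trans (sym (F.zeroʳ c))
            (trans (cong (c F.*_) (sym (proj₂ (𝓜-poly (f · h)) (length g) m<g))) (trans (coeffs (length g)) (proj₁ (𝓜-poly g))))))

  _∣ᴹ?_ : ∀ f g → Dec (f ∣ᴹ g)
  f ∣ᴹ? g = map′ ∣ᴾ⇒∣ᴹ ∣ᴹ⇒∣ᴾ (f ∣ᴾ? poly g)

  ∣ᴾ-combination : ∀ {d G H} → d ∣ᴾ G → d ∣ᴾ H → ∀ x y → d ∣ᴾ (x * G + y * H)
  ∣ᴾ-combination {d} {G} {H} (a , ea) (b , eb) x y = x * a + y * b , (begin
    poly d * (x * a + y * b)            ≈⟨ solve 5 (λ d a b x y → (d :* (x :* a :+ y :* b)) := (x :* (d :* a) :+ y :* (d :* b))) ≋-refl (poly d) a b x y ⟩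
    x * (poly d * a) + y * (poly d * b) ≈⟨ +-cong (*-congˡ x ea) (*-congˡ y eb) ⟩
    x * G + y * H                       ∎)
    where open ≋-Reasoning

  ∣ᴾ-resp : ∀ {d G H} → G ≋ H → d ∣ᴾ G → d ∣ᴾ H
  ∣ᴾ-resp e (a , ea) = a , ≋-trans ea e

  record Bezout (f : Monic) (G : Poly) : Set where
    field
      d   : Monic
      x y : Poly
      d∣f : d ∣ᴾ poly f
      d∣G : d ∣ᴾ G
      combination : poly d ≋ x * poly f + y * G

  -- The Euclidean algorithm, with n bounding the degree of f. The remainder R = c g is made monic
  -- and the pair (g, f) takes over; with k = 1 / c, the relation g = k G - k Q f is substituted
  -- back into the combination.
  bezout : ∀ n f G → length f < n → Bezout f G
  bezout (suc n) f G (s≤s f≤n) with divMod f G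
  ... | Q , R , G≋ , lR with normalise R
  ...   | inj₁ R≋0 = record
    { d = f ; x = F.1# ∷ [] ; y = []
    ; d∣f = F.1# ∷ [] , ≋-trans (*-comm (poly f) _) (*-identityˡ _)
    ; d∣G = Q , ≋-sym (≋-trans G≋ (≋-trans (+-cong ≋-refl R≋0) (+-identityʳ _)))
    ; combination = ≋-sym (≋-trans (+-identityʳ _) (*-identityˡ _)) }
  ...   | inj₂ (c , g , c≢0 , R≋ , g<R) = record
    { d = B.d ; x = B.x * (- (k * Q)) + B.y ; y = B.x * k
    ; d∣f = B.d∣G
    ; d∣G = ∣ᴾ-resp {B.d} (begin
        Q * poly f + (c ∷ []) * poly g  ≈⟨ +-cong (*-comm Q (poly f)) (≋-trans (const-* c (poly g)) (≋-sym R≋)) ⟩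
        poly f * Q + R                  ≈⟨ G≋ ⟨
        G                               ∎) (∣ᴾ-combination {B.d} B.d∣G B.d∣f Q (c ∷ []))
    ; combination = begin
        poly B.d                        ≈⟨ B.combination ⟩
        B.x * poly g + B.y * poly f     ≈⟨ +-cong (*-congˡ B.x g≋) ≋-refl ⟩
        B.x * (k * G + (- (k * Q)) * poly f) + B.y * poly f
          ≈⟨ solve 6 (λ x y k g u f → (x :* (k :* g :+ u :* f) :+ y :* f) := ((x :* u :+ y) :* f :+ (x :* k) :* g)) ≋-refl
               B.x B.y k G (- (k * Q)) (poly f) ⟩
        (B.x * (- (k * Q)) + B.y) * poly f + (B.x * k) * G ∎ }
    where
    open ≋-Reasoning
    module B = Bezout (bezout n g (poly f) (ℕ.<-≤-trans g<R (ℕ.≤-trans (ℕ.≤-reflexive lR) f≤n)))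
    const-* : ∀ e H → (e ∷ []) * H ≋ e ⋆ H
    const-* e H = ≋-trans (+-cong ≋-refl 0∷[]) (+-identityʳ _)
    k = proj₁ (inverse c c≢0) ∷ []
    g≋ : poly g ≋ k * G + (- (k * Q)) * poly f
    g≋ = begin
      poly g                                          ≈⟨ 1⋆ (poly g) ⟨
      F.1# ⋆ poly g                                   ≈⟨ ⋆-cong (trans (F.*-comm _ c) (proj₂ (inverse c c≢0))) ≋-refl ⟨
      (proj₁ (inverse c c≢0) F.* c) ⋆ poly g          ≈⟨ ⋆-⋆ _ c (poly g) ⟨
      proj₁ (inverse c c≢0) ⋆ (c ⋆ poly g)            ≈⟨ ⋆-cong refl R≋ ⟨
      proj₁ (inverse c c≢0) ⋆ R                       ≈⟨ const-* _ R ⟨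
      k * R                                           ≈⟨ +-identityʳ _ ⟨
      k * R + []                                      ≈⟨ +-cong ≋-refl (-‿inverseʳ (k * Q * poly f)) ⟨
      k * R + (k * Q * poly f + (- (k * Q * poly f))) ≈⟨ +-assoc (k * R) _ _ ⟨
      (k * R + k * Q * poly f) + (- (k * Q * poly f))
        ≈⟨ +-cong (solve 4 (λ k r q f → (k :* r :+ k :* q :* f) := (k :* (f :* q :+ r))) ≋-refl k R Q (poly f)) (PolyProperties.-‿distribˡ-* (k * Q) (poly f)) ⟩
      k * (poly f * Q + R) + (- (k * Q)) * poly f     ≈⟨ +-cong (*-congˡ k G≋) ≋-refl ⟨
      k * G + (- (k * Q)) * poly f                    ∎

  -- The field `degrees` is the logarithm of |f| |g| = |gcd| |lcm|.
  record GcdLcm (f g : Monic) : Set where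
    field
      h l       : Monic
      h∣f       : h ∣ᴹ f
      h∣g       : h ∣ᴹ g
      greatest  : ∀ {d} → d ∣ᴹ f → d ∣ᴹ g → d ∣ᴹ h
      f∣l       : f ∣ᴹ l
      g∣l       : g ∣ᴹ l
      least     : ∀ {m} → f ∣ᴹ m → g ∣ᴹ m → l ∣ᴹ m
      degrees   : length f ℕ.+ length g ≡ length h ℕ.+ length l

  -- Write f = h f′ and g = h g′. Cancelling h in the Bézout identity gives x f′ + y g′ = 1. A
  -- common multiple h f′ a = h g′ b has f′ a = g′ b, hence a = g′ (x b + y a), and so h f′ g′
  -- divides it.
  gcdLcm : ∀ f g → GcdLcm f g
  gcdLcm f g with bezout (suc (length f)) f (poly g) ℕ.≤-refl
  ... | record { d = h ; x = x ; y = y ; d∣f = d∣f ; d∣G = d∣G ; combination = comb }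
    with ∣ᴾ⇒∣ᴹ {h} {f} d∣f | ∣ᴾ⇒∣ᴹ {h} {g} d∣G
  ... | f′ , refl | g′ , refl = record
    { h = h ; l = h · f′ · g′
    ; h∣f = f′ , refl
    ; h∣g = g′ , refl
    ; greatest = λ {d} df dg → ∣ᴾ⇒∣ᴹ (∣ᴾ-resp {d} (≋-sym comb) (∣ᴾ-combination {d} (∣ᴹ⇒∣ᴾ df) (∣ᴹ⇒∣ᴾ dg) x y))
    ; f∣l = g′ , refl
    ; g∣l = f′ , trans (·-assoc h g′ f′) (trans (cong (h ·_) (·-comm g′ f′)) (sym (·-assoc h f′ g′)))
    ; least = least
    ; degrees = begin
        length (h · f′) ℕ.+ length (h · g′)          ≡⟨ cong (length (h · f′) ℕ.+_) (length-· h g′) ⟩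
        length (h · f′) ℕ.+ (length h ℕ.+ length g′) ≡⟨ solve-+ (length (h · f′)) (length h) (length g′) ⟩
        length h ℕ.+ (length (h · f′) ℕ.+ length g′) ≡⟨ cong (length h ℕ.+_) (length-· (h · f′) g′) ⟨
        length h ℕ.+ length (h · f′ · g′)            ∎ }
    where
    open ≡-Reasoning
    solve-+ : ∀ a b c → a ℕ.+ (b ℕ.+ c) ≡ b ℕ.+ (a ℕ.+ c)
    solve-+ a b c = trans (sym (ℕ.+-assoc a b c)) (trans (cong (ℕ._+ c) (ℕ.+-comm a b)) (ℕ.+-assoc b a c))
    comaximal : x * poly f′ + y * poly g′ ≋ F.1# ∷ []
    comaximal = poly*-cancel h (R.begin
      poly h * (x * poly f′ + y * poly g′)
        R.≈⟨ solve 5 (λ h x y f g → (h :* (x :* f :+ y :* g)) := (x :* (h :* f) :+ y :* (h :* g))) ≋-refl (poly h) x y (poly f′) (poly g′) ⟩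
      x * (poly h * poly f′) + y * (poly h * poly g′)
        R.≈⟨ +-cong (*-congˡ x (poly-· h f′)) (*-congˡ y (poly-· h g′)) ⟨
      x * poly (h · f′) + y * poly (h · g′)  R.≈⟨ comb ⟨
      poly h                                 R.≈⟨ *-identityˡ _ ⟨
      (F.1# ∷ []) * poly h                   R.≈⟨ *-comm _ (poly h) ⟩
      poly h * (F.1# ∷ [])                   R.∎)
      where module R = ≋-Reasoning
    least : ∀ {m} → h · f′ ∣ᴹ m → h · g′ ∣ᴹ m → h · f′ · g′ ∣ᴹ m
    least (a , refl) (b , e) = go (∣ᴾ⇒∣ᴹ g′∣a)
      where
      f′a≡g′b : f′ · a ≡ g′ · b
      f′a≡g′b = ·-cancelˡ h (trans (sym (·-assoc h f′ a)) (trans (sym e) (·-assoc h g′ b)))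
      g′∣a : g′ ∣ᴾ poly a
      g′∣a = x * poly b + y * poly a , (R.begin
        poly g′ * (x * poly b + y * poly a)
          R.≈⟨ solve 5 (λ g x y a b → (g :* (x :* b :+ y :* a)) := (x :* (g :* b) :+ y :* g :* a)) ≋-refl (poly g′) x y (poly a) (poly b) ⟩
        x * (poly g′ * poly b) + y * poly g′ * poly a
          R.≈⟨ +-cong (*-congˡ x (≋-trans (≋-sym (poly-· g′ b)) (≋-trans (≡⇒≋ (sym f′a≡g′b)) (poly-· f′ a)))) ≋-refl ⟩
        x * (poly f′ * poly a) + y * poly g′ * poly a
          R.≈⟨ solve 5 (λ g x y a f → (x :* (f :* a) :+ y :* g :* a) := ((x :* f :+ y :* g) :* a)) ≋-refl (poly g′) x y (poly a) (poly f′) ⟩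
        (x * poly f′ + y * poly g′) * poly a  R.≈⟨ *-cong comaximal ≋-refl ⟩
        (F.1# ∷ []) * poly a                  R.≈⟨ *-identityˡ _ ⟩
        poly a                                R.∎)
        where
        module R = ≋-Reasoning
        ≡⇒≋ : ∀ {u v} → u ≡ v → poly u ≋ poly v
        ≡⇒≋ refl = ≋-refl
      go : g′ ∣ᴹ a → h · f′ · g′ ∣ᴹ h · f′ · a
      go (t , refl) = t , ·-assoc (h · f′) g′ t

  length-translate : ∀ u r → length r ≤ length u → length (u - r) ≡ length u
  length-translate u r r≤u = go u (- r) (ℕ.≤-trans (ℕ.≤-reflexive (length-map _ r)) r≤u)
    where
    go : ∀ u s → length s ≤ length u → length (u + s) ≡ length u
    go []      []      _       = refl
    go (c ∷ u) []      _       = refl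
    go (c ∷ u) (d ∷ s) (s≤s l) = cong suc (go u s l)

  ++-translate : ∀ u r w → length r ≤ length u → (u - r) ++ w ≡ (u ++ w) - r
  ++-translate u r w r≤u = go u (- r) (ℕ.≤-trans (ℕ.≤-reflexive (length-map _ r)) r≤u)
    where
    nil : ∀ w → w ≡ w + []
    nil []      = refl
    nil (_ ∷ _) = refl
    go : ∀ u s → length s ≤ length u → (u + s) ++ w ≡ (u ++ w) + s
    go (c ∷ u) []      _       = refl
    go (c ∷ u) (d ∷ s) (s≤s l) = cong (c F.+ d ∷_) (go u s l)
    go []      []      _       = nil w

  ≋⇒≡ : ∀ {u v} → length u ≡ length v → u ≋ v → u ≡ v
  ≋⇒≡ {[]}    {[]}    _ _ = refl
  ≋⇒≡ {c ∷ u} {d ∷ v} l e =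
    cong₂ _∷_ (proj₁ (∷-injective-≋ e)) (≋⇒≡ (ℕ.suc-injective l) (proj₂ (∷-injective-≋ e)))

  u+r-r≋u : ∀ u r → (u + r) - r ≋ u
  u+r-r≋u u r = ≋-trans (+-assoc u r (- r)) (≋-trans (+-cong ≋-refl (-‿inverseʳ r)) (+-identityʳ u))

  u-r+r≋u : ∀ u r → (u - r) + r ≋ u
  u-r+r≋u u r = ≋-trans (+-assoc u (- r) r)
    (≋-trans (+-cong ≋-refl (≋-trans (+-comm (- r) r) (-‿inverseʳ r))) (+-identityʳ u))

  translate-injective : ∀ {u v} r → length u ≡ length v → u - r ≡ v - r → u ≡ v
  translate-injective {u} {v} r l e = ≋⇒≡ l (≋-trans (≋-sym (u-r+r≋u u r))
    (≋-trans (+-cong {u - r} {v - r} (subst (u - r ≋_) e ≋-refl) ≋-refl) (u-r+r≋u v r)))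

  translate-surjective : ∀ u r → length r ≤ length u → ∃ λ v → length v ≡ length u × u ≡ v - r
  -- Adding r is written as subtracting -r, so that `length-translate` covers it as well.
  translate-surjective u r r≤u = u - (- r) , l₁ , ≋⇒≡ (sym (trans l₂ l₁)) (≋-sym (≋-trans
      (+-cong {u - (- r)} (+-cong {u} ≋-refl (≈⇒≋ λ n → cong (λ s → coeff s n) (neg-neg r))) ≋-refl) (u+r-r≋u u r)))
    where
    neg-neg : ∀ r → - (- r) ≡ r
    neg-neg []      = refl
    neg-neg (c ∷ r) = cong₂ _∷_ (FieldProperties.-‿involutive c) (neg-neg r)
    -r≤u : length (- r) ≤ length u
    -r≤u = ℕ.≤-trans (ℕ.≤-reflexive (length-map _ r)) r≤u
    l₁ = length-translate u (- r) -r≤u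
    l₂ = length-translate (u - (- r)) r (ℕ.≤-trans r≤u (ℕ.≤-reflexive (sym l₁)))

  remainder : Monic → Poly → List F.Carrier
  remainder f G = proj₁ (proj₂ (divMod f G))

  length-remainder : ∀ f G → length (remainder f G) ≡ length f
  length-remainder f G = proj₂ (proj₂ (proj₂ (divMod f G)))

  remainder-≡⇒∣ᴾ : ∀ f G {r} → r ≡ remainder f G → f ∣ᴾ G - r
  remainder-≡⇒∣ᴾ f G refl with divMod f G
  ... | Q , R , G≋ , _ = Q , ≋-sym (≋-trans (+-cong G≋ ≋-refl) (u+r-r≋u (poly f * Q) R))

  -- Uniqueness of division: of all words of length deg f, exactly one makes G - r divisible by f.
  -- This is why the average over residues in the interval count equals 1 at every point.
  ∣ᴾ⇒remainder-≡ : ∀ f G {r} → length r ≡ length f → f ∣ᴾ G - r → r ≡ remainder f G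
  ∣ᴾ⇒remainder-≡ f G {r} lr (Q′ , e) with divMod f G
  ... | Q , R , G≋ , lR = ≋⇒≡ (trans lr (sym lR)) (divMod-unique f
        (≋-trans (+-cong e ≋-refl) (≋-trans (u-r+r≋u G r) G≋)) (ℕ.≤-reflexive lr) (ℕ.≤-reflexive lR))

  -- Lists are subtracted from the constant term upwards, so a short r touches only the block u and
  -- leaves t and the leading 1 alone.
  poly-translate : ∀ u r t → length r ≤ length u → poly ((u - r) ++ t) ≡ poly (u ++ t) - r
  poly-translate u r t r≤u = begin
    ((u - r) ++ t) ++ F.1# ∷ []   ≡⟨ ++-assoc (u - r) t _ ⟩
    (u - r) ++ poly t             ≡⟨ ++-translate u r (poly t) r≤u ⟩
    (u ++ poly t) - r             ≡⟨ cong (_- r) (++-assoc u t _) ⟨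
    poly (u ++ t) - r             ∎
    where open ≡-Reasoning

-- Enumeration of monic polynomials and sums over multiples.

module Counting {q : ℕ} (K : FiniteField q) where
  open import Data.Integer.Base using (_+_; _*_; -_; _-_; _^_)
  open Monics K public hiding (_+_; _*_; -_; _-_; module F)
  open FiniteField K using (Carrier; enumeration)

  Q : ℤ
  Q = + q

  elements : List Carrier
  elements = map (Inverse.to enumeration) (allFin q)

  -- These lists have three uses: monic polynomials of degree n, residues modulo a polynomial of
  -- degree n, and the free low coefficients of an interval.
  words : ℕ → List Monic
  words zero    = [] ∷ []
  words (suc n) = cartesianProductWith _∷_ elements (words n)

  upto : ℕ → List Monic
  upto zero    = words 0
  upto (suc n) = upto n ++ words (suc n)

  ∈-elements : ∀ c → c ∈ elements
  ∈-elements c = subst (_∈ elements) (Inverse.strictlyInverseˡ enumeration c) (∈-map⁺ _ (∈-allFin _))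

  elements! : Unique elements
  elements! = Unique.map⁺ (Injection.injective (↔⇒↣ enumeration)) (Unique.allFin⁺ q)

  ∈-words⁺ : ∀ f → f ∈ words (length f)
  ∈-words⁺ []      = here refl
  ∈-words⁺ (c ∷ f) = ∈-cartesianProductWith⁺ _∷_ (∈-elements c) (∈-words⁺ f)

  ∈-words : ∀ {n} f → length f ≡ n → f ∈ words n
  ∈-words f refl = ∈-words⁺ f

  ∈-words⁻ : ∀ n {f} → f ∈ words n → length f ≡ n
  ∈-words⁻ zero    (here refl) = refl
  ∈-words⁻ (suc n) f∈ with ∈-cartesianProductWith⁻ _∷_ elements (words n) f∈
  ... | c , g , _ , g∈ , refl = cong suc (∈-words⁻ n g∈)

  words! : ∀ n → Unique (words n)
  words! zero    = [] ∷ []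
  words! (suc n) = Unique.cartesianProductWith⁺ _∷_ ∷-injective elements! (words! n)

  length-words : ∀ n → + length (words n) ≡ Q ^ n
  length-words zero    = refl
  length-words (suc n) = begin
    + length (cartesianProductWith _∷_ elements (words n))  ≡⟨ cong +_ (length-cartesianProductWith _∷_ elements (words n)) ⟩
    + (length elements ℕ.* length (words n))               ≡⟨ ℤ.pos-* (length elements) _ ⟩
    + length elements * + length (words n)                 ≡⟨ cong₂ (λ a b → + a * b) (trans (length-map _ (allFin q)) (length-tabulate {n = q} _)) (length-words n) ⟩
    Q * Q ^ n                                              ∎
    where open ≡-Reasoning

  ∑-words-const : ∀ n c → ∑ (words n) (λ _ → c) ≡ Q ^ n * c
  ∑-words-const n c = trans (∑-const (words n) c) (cong (_* c) (length-words n))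

  ∑-words-1 : ∀ n → ∑ (words n) (λ _ → 1ℤ) ≡ Q ^ n
  ∑-words-1 n = trans (∑-words-const n 1ℤ) (ℤ.*-identityʳ _)

  ∈-upto : ∀ n f → length f ≤ n → f ∈ upto n
  ∈-upto zero    [] _ = here refl
  ∈-upto (suc n) f  l with ℕ.m≤n⇒m<n∨m≡n l
  ... | inj₁ (s≤s l≤n) = ∈-++⁺ˡ (∈-upto n f l≤n)
  ... | inj₂ l≡        = ∈-++⁺ʳ (upto n) (∈-words f l≡)

  ∈-upto⁻ : ∀ n {f} → f ∈ upto n → length f ≤ n
  ∈-upto⁻ zero    (here refl) = z≤n
  ∈-upto⁻ (suc n) f∈ with ∈-++⁻ (upto n) f∈
  ... | inj₁ f∈ = ℕ.m≤n⇒m≤1+n (∈-upto⁻ n f∈)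
  ... | inj₂ f∈ = ℕ.≤-reflexive (∈-words⁻ (suc n) f∈)

  upto! : ∀ n → Unique (upto n)
  upto! zero    = words! 0
  upto! (suc n) = Unique.++⁺ (upto! n) (words! (suc n))
    λ (p , r) → ℕ.1+n≰n (ℕ.≤-trans (ℕ.≤-reflexive (sym (∈-words⁻ (suc n) r))) (∈-upto⁻ n p))

  -- Grouping D by its degree k, the factor b(n - k) comes out and a Cauchy product remains.
  ∑-upto-conv : ∀ x b n →
    ∑ (upto n) (λ D → x D * b (n ∸ length D)) ≡ conv (λ k → ∑ (words k) x) b n
  ∑-upto-conv x b zero    = shuffle (x []) (b 0)
    where
    shuffle : ∀ u v → u * v + 0ℤ ≡ (u + 0ℤ) * v
    shuffle = solve-∀
  ∑-upto-conv x b (suc n) = trans (∑-++ (upto n) (words (suc n)) _) (cong₂ _+_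
    -- Since deg D ≤ n, the subtraction does not truncate and (n + 1) - deg D = 1 + (n - deg D): the
    -- lower degrees see b shifted by one.
    (trans (∑-cong∈ (upto n) λ {D} D∈ → cong (λ k → x D * b k) (ℕ.+-∸-assoc 1 (∈-upto⁻ n D∈)))
           (∑-upto-conv x (b ∘ suc) n))
    (trans (∑-cong∈ (words (suc n)) λ {D} D∈ → cong (λ k → x D * b k)
              (trans (cong (suc n ∸_) (∈-words⁻ (suc n) D∈)) (ℕ.n∸n≡0 n)))
           (∑-*ʳ (words (suc n)) (b 0) x)))

  ∣ᴹ⇒≤ : ∀ {G D} → G ∣ᴹ D → length G ≤ length D
  ∣ᴹ⇒≤ {G} (h , refl) = ℕ.≤-trans (ℕ.m≤m+n _ _) (ℕ.≤-reflexive (sym (length-· G h)))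

  cofactor-length : ∀ G {h n} → length (G · h) ≡ n → length h ≡ n ∸ length G
  cofactor-length G {h} refl = sym (trans (cong (_∸ length G) (length-· G h)) (ℕ.m+n∸m≡n (length G) (length h)))

  ∑-multiples-words : ∀ G n (f : Monic → ℤ) → length G ≤ n →
    ∑ (words n) (λ X → ⟦ G ∣ᴹ? X ⟧ * f X) ≡ ∑ (words (n ∸ length G)) (λ Y → f (G · Y))
  ∑-multiples-words G n f G≤n = trans
    (∑-reindex _≟ᴹ_ (G ·_) _ (words! n) (words! (n ∸ length G))
      (λ {Y} Y∈ → ∈-words (G · Y) (trans (length-· G Y)
        (trans (cong (length G ℕ.+_) (∈-words⁻ _ Y∈)) (ℕ.m+[n∸m]≡n G≤n))))
      (λ _ _ → ·-cancelˡ G)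
      λ {X} X∈ → onto X∈ (G ∣ᴹ? X))
    (∑-cong (words (n ∸ length G)) λ Y → trans (cong (_* f (G · Y)) (⟦⟧-yes (G ∣ᴹ? G · Y) (Y , refl))) (ℤ.*-identityˡ _))
    where
    onto : ∀ {X} → X ∈ words n → (d : Dec (G ∣ᴹ X)) →
           (∃ λ Y → Y ∈ words (n ∸ length G) × X ≡ G · Y) ⊎ ⟦ d ⟧ * f X ≡ 0ℤ
    onto X∈ (yes (Y , refl)) = inj₁ (Y , ∈-words Y (cofactor-length G (∈-words⁻ n X∈)) , refl)
    onto X∈ (no _)           = inj₂ refl

  ∑-multiples-upto : ∀ G n (f : Monic → ℤ) → length G ≤ n →
    ∑ (upto n) (λ X → ⟦ G ∣ᴹ? X ⟧ * f X) ≡ ∑ (upto (n ∸ length G)) (λ Y → f (G · Y))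
  ∑-multiples-upto G n f G≤n = trans
    (∑-reindex _≟ᴹ_ (G ·_) _ (upto! n) (upto! (n ∸ length G))
      (λ {Y} Y∈ → ∈-upto n (G · Y) (ℕ.≤-trans (ℕ.≤-reflexive (length-· G Y))
        (ℕ.≤-trans (ℕ.+-monoʳ-≤ (length G) (∈-upto⁻ _ Y∈)) (ℕ.≤-reflexive (ℕ.m+[n∸m]≡n G≤n)))))
      (λ _ _ → ·-cancelˡ G)
      λ {X} X∈ → onto X∈ (G ∣ᴹ? X))
    (∑-cong (upto (n ∸ length G)) λ Y → trans (cong (_* f (G · Y)) (⟦⟧-yes (G ∣ᴹ? G · Y) (Y , refl))) (ℤ.*-identityˡ _))
    where
    onto : ∀ {X} → X ∈ upto n → (d : Dec (G ∣ᴹ X)) →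
           (∃ λ Y → Y ∈ upto (n ∸ length G) × X ≡ G · Y) ⊎ ⟦ d ⟧ * f X ≡ 0ℤ
    onto X∈ (yes (Y , refl)) = inj₁ (Y , ∈-upto _ Y
      (ℕ.≤-trans (ℕ.≤-reflexive (cofactor-length G refl)) (ℕ.∸-monoˡ-≤ (length G) (∈-upto⁻ n X∈))) , refl)
    onto X∈ (no _)           = inj₂ refl

  -- A divisor of degree d has q^(n - d) multiples of degree n. In terms of series, passing to
  -- divisor sums multiplies by 1 / (1 - q u), the series of all monic polynomials. Both λ and φ are
  -- handled in this way.
  ∑-divisor-pairs : ∀ x n →
    ∑ (words n) (λ X → ∑ (upto n) (λ D → ⟦ D ∣ᴹ? X ⟧ * x D)) ≡ conv (λ k → ∑ (words k) x) (Q ^_) n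
  ∑-divisor-pairs x n = begin
    ∑ (words n) (λ X → ∑ (upto n) (λ D → ⟦ D ∣ᴹ? X ⟧ * x D))  ≡⟨ ∑-swap (words n) (upto n) (λ X D → ⟦ D ∣ᴹ? X ⟧ * x D) ⟩
    ∑ (upto n) (λ D → ∑ (words n) (λ X → ⟦ D ∣ᴹ? X ⟧ * x D))  ≡⟨ ∑-cong∈ (upto n) (λ {D} D∈ → trans (∑-multiples-words D n (λ _ → x D) (∈-upto⁻ n D∈)) (trans (∑-words-const (n ∸ length D) (x D)) (ℤ.*-comm _ (x D)))) ⟩
    ∑ (upto n) (λ D → x D * Q ^ (n ∸ length D))              ≡⟨ ∑-upto-conv x (Q ^_) n ⟩
    conv (λ k → ∑ (words k) x) (Q ^_) n                      ∎
    where open ≡-Reasoning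

-- Prime factorisation and the Liouville function.

module Liouville {q : ℕ} (K : FiniteField q) where
  open import Data.Integer.Base using (_+_; _*_; -_; _-_; _^_)
  open Counting K public

  record Prime (P : Monic) : Set where
    field
      nonunit  : 1 ≤ length P
      divisors : ∀ {D} → D ∣ᴹ P → D ≡ [] ⊎ D ≡ P
  open Prime

  length≡0 : ∀ {f : Monic} → length f ≡ 0 → f ≡ []
  length≡0 {[]} _ = refl

  ∣ᴹ-refl : ∀ {f} → f ∣ᴹ f
  ∣ᴹ-refl {f} = [] , ·-identityʳ f

  ∣ᴹ-trans : ∀ {f g h} → f ∣ᴹ g → g ∣ᴹ h → f ∣ᴹ h
  ∣ᴹ-trans {f} (a , refl) (b , refl) = a · b , sym (·-assoc f a b)

  ∣ᴹ-·ʳ : ∀ f g → f ∣ᴹ g · f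
  ∣ᴹ-·ʳ f g = g , ·-comm f g

  ·-cancel-∣ᴹ : ∀ f {g h} → f · g ∣ᴹ f · h → g ∣ᴹ h
  ·-cancel-∣ᴹ f {g} (t , e) = t , ·-cancelˡ f (trans (sym (·-assoc f g t)) e)

  ·-mono-∣ᴹ : ∀ f {g h} → g ∣ᴹ h → f · g ∣ᴹ f · h
  ·-mono-∣ᴹ f {g} (t , refl) = t , ·-assoc f g t

  ∣ᴹ-length≡ : ∀ {f g} → f ∣ᴹ g → length f ≡ length g → f ≡ g
  ∣ᴹ-length≡ {f} (t , refl) e = trans (sym (·-identityʳ f)) (cong (f ·_) (sym (length≡0 t≡0)))
    where
    t≡0 : length t ≡ 0
    t≡0 = ℕ.+-cancelˡ-≡ (length f) _ _ (trans (sym (length-· f t)) (trans (sym e) (sym (ℕ.+-identityʳ _))))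

  -- The gcd of P and F is P or 1. If it is 1, the degrees force the lcm to be F P; as F G is a
  -- common multiple, F P divides F G, and F cancels.
  euclid : ∀ {P} F {G} → Prime P → P ∣ᴹ F · G → P ∣ᴹ F ⊎ P ∣ᴹ G
  euclid {P} F {G} p P∣FG = go (gcdLcm P F)
    where
    go : GcdLcm P F → P ∣ᴹ F ⊎ P ∣ᴹ G
    go gl with divisors p (GcdLcm.h∣f gl)
    ... | inj₂ h≡P = inj₁ (subst (_∣ᴹ F) h≡P (GcdLcm.h∣g gl))
    ... | inj₁ h≡1 = inj₂ (·-cancel-∣ᴹ F (subst (_∣ᴹ F · G) l≡FP (GcdLcm.least gl P∣FG (G , refl))))
      where
      l≡FP : GcdLcm.l gl ≡ F · P
      l≡FP = ∣ᴹ-length≡ (GcdLcm.least gl (∣ᴹ-·ʳ P F) (P , refl)) (sym (begin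
        length (F · P)                                    ≡⟨ length-· F P ⟩
        length F ℕ.+ length P                             ≡⟨ ℕ.+-comm (length F) _ ⟩
        length P ℕ.+ length F                             ≡⟨ GcdLcm.degrees gl ⟩
        length (GcdLcm.h gl) ℕ.+ length (GcdLcm.l gl)     ≡⟨ cong (λ h → length h ℕ.+ length (GcdLcm.l gl)) h≡1 ⟩
        length (GcdLcm.l gl)                              ∎))
        where open ≡-Reasoning

  primeDivisor : ∀ n F → length F ≤ n → 1 ≤ length F → ∃ λ P → Prime P × P ∣ᴹ F
  primeDivisor zero    F F≤0 1≤F = contradiction (ℕ.≤-trans 1≤F F≤0) λ ()
  primeDivisor (suc n) F F≤n 1≤F
    with any? (λ D → D ∣ᴹ? F ×-dec ((1 ℕ.≤? length D) ×-dec (length D ℕ.<? length F))) (upto (length F))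
  ... | yes found with find found
  ...   | D , _ , D∣F , 1≤D , D<F with primeDivisor n D (ℕ.≤-pred (ℕ.≤-trans D<F F≤n)) 1≤D
  ...     | P , p , P∣D = P , p , ∣ᴹ-trans P∣D D∣F
  primeDivisor (suc n) F F≤n 1≤F
      | no none = F , record { nonunit = 1≤F ; divisors = divs } , ∣ᴹ-refl
    where
    divs : ∀ {D} → D ∣ᴹ F → D ≡ [] ⊎ D ≡ F
    divs {D} D∣F with 1 ℕ.≤? length D | length D ℕ.<? length F
    ... | no ¬1≤D  | _       = inj₁ (length≡0 (ℕ.n<1⇒n≡0 (ℕ.≰⇒> ¬1≤D)))
    ... | yes _    | no ¬D<F = inj₂ (∣ᴹ-length≡ D∣F (ℕ.≤-antisym (∣ᴹ⇒≤ D∣F) (ℕ.≮⇒≥ ¬D<F)))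
    ... | yes 1≤D  | yes D<F = contradiction (lose (∈-upto (length F) D (∣ᴹ⇒≤ D∣F)) (D∣F , 1≤D , D<F)) none

  ∏ : List Monic → Monic
  ∏ = foldr _·_ []

  ∏-++ : ∀ ps qs → ∏ (ps ++ qs) ≡ ∏ ps · ∏ qs
  ∏-++ []       qs = sym (·-identityˡ _)
  ∏-++ (p ∷ ps) qs = trans (cong (p ·_) (∏-++ ps qs)) (sym (·-assoc p (∏ ps) (∏ qs)))

  Factorisation : Monic → List Monic → Set
  Factorisation F ps = All Prime ps × ∏ ps ≡ F

  factorise : ∀ n F → length F ≤ n → ∃ (Factorisation F)
  factorise n       []        _   = [] , [] , refl
  factorise (suc n) F@(_ ∷ _) F≤n with primeDivisor (length F) F ℕ.≤-refl (s≤s z≤n)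
  ... | P , p , G , PG≡F with factorise n G (ℕ.≤-pred (ℕ.≤-trans (ℕ.≤-trans (ℕ.+-monoˡ-≤ (length G) (nonunit p))
                                  (ℕ.≤-reflexive (trans (sym (length-· P G)) (cong length PG≡F)))) F≤n))
  ...   | ps , primes , e = P ∷ ps , p ∷ primes , trans (cong (P ·_) e) PG≡F

  primes-¬unit : ∀ {P F} → Prime P → ¬ P · F ≡ []
  primes-¬unit {P} {F} p e =
    ℕ.<⇒≢ (ℕ.≤-trans (nonunit p) (ℕ.m≤m+n (length P) (length F))) (sym (trans (sym (length-· P F)) (cong length e)))

  remove-prime : ∀ {P} qs → Prime P → All Prime qs → P ∣ᴹ ∏ qs →
                 ∃ λ qs′ → All Prime qs′ × ∏ qs ≡ P · ∏ qs′ × length qs ≡ suc (length qs′)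
  remove-prime []       p []         (t , e) = contradiction e (primes-¬unit p)
  remove-prime {P} (R ∷ qs) p (r ∷ primes) P∣ with euclid R p P∣
  ... | inj₁ P∣R with divisors r P∣R
  ...   | inj₁ refl = contradiction (nonunit p) λ ()
  ...   | inj₂ refl = qs , primes , refl , refl
  remove-prime {P} (R ∷ qs) p (r ∷ primes) P∣ | inj₂ P∣qs with remove-prime qs p primes P∣qs
  ... | qs′ , primes′ , e , l = R ∷ qs′ , r ∷ primes′ ,
        trans (cong (R ·_) e) (trans (sym (·-assoc R P _)) (trans (cong (_· ∏ qs′) (·-comm R P)) (·-assoc P R _))) ,
        cong suc l

  -- λ depends only on the number of prime factors, so uniqueness is needed for the length alone:
  -- each prime of one factorisation is removed from the other.
  factorisation-length : ∀ {F} ps qs → Factorisation F ps → Factorisation F qs → length ps ≡ length qs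
  factorisation-length []       []       _            _             = refl
  factorisation-length []       (_ ∷ _)  (_ , refl)   (q ∷ _ , e)   = contradiction e (primes-¬unit q)
  factorisation-length (P ∷ ps) qs       (p ∷ primes , refl) (primes′ , e)
    with remove-prime qs p primes′ (∏ ps , sym e)
  ... | qs′ , primes″ , e′ , l = trans (cong suc
        (factorisation-length ps qs′ (primes , refl) (primes″ , ·-cancelˡ P (trans (sym e′) e)))) (sym l)

  Ω : Monic → ℕ
  Ω F = length (proj₁ (factorise (length F) F ℕ.≤-refl))

  Ω-unique : ∀ {F} ps → Factorisation F ps → Ω F ≡ length ps
  Ω-unique {F} ps = factorisation-length _ ps (proj₂ (factorise (length F) F ℕ.≤-refl))

  Ω-· : ∀ F G → Ω (F · G) ≡ Ω F ℕ.+ Ω G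
  Ω-· F G with factorise (length F) F ℕ.≤-refl | factorise (length G) G ℕ.≤-refl
  ... | ps , primes , e | qs , primes′ , e′ =
    trans (Ω-unique (ps ++ qs) (All.++⁺ primes primes′ , trans (∏-++ ps qs) (cong₂ _·_ e e′))) (length-++ ps)

  liouville : Monic → ℤ
  liouville F = -1ℤ ^ Ω F

  liouville-· : ∀ F G → liouville (F · G) ≡ liouville F * liouville G
  liouville-· F G = trans (cong (-1ℤ ^_) (Ω-· F G)) (ℤ.^-distribˡ-+-* -1ℤ (Ω F) (Ω G))

  liouville-square : ∀ F → liouville F * liouville F ≡ 1ℤ
  liouville-square F = go (Ω F)
    where
    shuffle : ∀ x → (-1ℤ * x) * (-1ℤ * x) ≡ x * x
    shuffle = solve-∀
    go : ∀ n → (-1ℤ ^ n) * (-1ℤ ^ n) ≡ 1ℤ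
    go zero    = refl
    go (suc n) = trans (shuffle (-1ℤ ^ n)) (go n)

  liouville-[] : liouville [] ≡ 1ℤ
  liouville-[] = cong (-1ℤ ^_) (Ω-unique [] ([] , refl))

  liouville-prime-· : ∀ {P} → Prime P → ∀ F → liouville (P · F) ≡ - liouville F
  liouville-prime-· {P} p F = trans (liouville-· P F)
    (trans (cong (λ n → (-1ℤ ^ n) * liouville F) (Ω-unique (P ∷ []) (p ∷ [] , ·-identityʳ P))) (ℤ.-1*i≡-i (liouville F)))

-- Divisor sums of λ, square roots, and the generating series of λ.

module LiouvilleSums {q : ℕ} (K : FiniteField q) where
  open import Data.Integer.Base using (_+_; _*_; -_; _-_; _^_)
  open Liouville K public

  -- Allows the divisor sums of different polynomials to be compared over one common range.
  ∑-divisors-bound : ∀ F n (x : Monic → ℤ) → length F ≤ n →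
    ∑ (upto n) (λ D → ⟦ D ∣ᴹ? F ⟧ * x D) ≡ ∑ (upto (length F)) (λ D → ⟦ D ∣ᴹ? F ⟧ * x D)
  ∑-divisors-bound F n x F≤n = ∑-⊆ _≟ᴹ_ _ (upto! n) (upto! (length F))
    (λ {D} D∈ → ∈-upto n D (ℕ.≤-trans (∈-upto⁻ (length F) D∈) F≤n))
    (λ {D} _ → inside (D ∣ᴹ? F))
    where
    inside : ∀ {D} (d : Dec (D ∣ᴹ F)) → D ∈ upto (length F) ⊎ ⟦ d ⟧ * x D ≡ 0ℤ
    inside {D} (yes D∣F) = inj₁ (∈-upto (length F) D (∣ᴹ⇒≤ D∣F))
    inside     (no _)    = inj₂ refl

  divisorSum : Monic → ℤ
  divisorSum F = ∑ (upto (length F)) (λ D → ⟦ D ∣ᴹ? F ⟧ * liouville D)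

  multipleSum : Monic → Monic → ℕ → ℤ
  multipleSum P F n = ∑ (upto n) (λ D → ⟦ P ∣ᴹ? D ⟧ * (⟦ D ∣ᴹ? F ⟧ * liouville D))

  -- Put D = P Y: then P Y divides P F exactly when Y divides F, and λ(P Y) = -λ(Y).
  multipleSum-· : ∀ {P} → Prime P → ∀ F n → length (P · F) ≤ n → multipleSum P (P · F) n ≡ - divisorSum F
  multipleSum-· {P} p F n PF≤n = begin
    multipleSum P (P · F) n
      ≡⟨ ∑-multiples-upto P n _ (ℕ.≤-trans (ℕ.m≤m+n (length P) (length F)) P+F≤n) ⟩
    ∑ (upto (n ∸ length P)) (λ Y → ⟦ P · Y ∣ᴹ? P · F ⟧ * liouville (P · Y))
      ≡⟨ ∑-cong (upto (n ∸ length P)) (λ Y → cong₂ _*_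
           (⟦⟧-cong (P · Y ∣ᴹ? P · F) (Y ∣ᴹ? F) (·-cancel-∣ᴹ P) (·-mono-∣ᴹ P)) (liouville-prime-· p Y)) ⟩
    ∑ (upto (n ∸ length P)) (λ Y → ⟦ Y ∣ᴹ? F ⟧ * - liouville Y)
      ≡⟨ ∑-divisors-bound F (n ∸ length P) (λ Y → - liouville Y) F≤ ⟩
    ∑ (upto (length F)) (λ Y → ⟦ Y ∣ᴹ? F ⟧ * - liouville Y)
      ≡⟨ ∑-cong (upto (length F)) (λ Y → neg (⟦ Y ∣ᴹ? F ⟧) (liouville Y)) ⟩
    ∑ (upto (length F)) (λ Y → -1ℤ * (⟦ Y ∣ᴹ? F ⟧ * liouville Y))
      ≡⟨ ∑-*ˡ (upto (length F)) -1ℤ (λ Y → ⟦ Y ∣ᴹ? F ⟧ * liouville Y) ⟩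
    -1ℤ * divisorSum F
      ≡⟨ ℤ.-1*i≡-i (divisorSum F) ⟩
    - divisorSum F ∎
    where
    open ≡-Reasoning
    P+F≤n : length P ℕ.+ length F ≤ n
    P+F≤n = ℕ.≤-trans (ℕ.≤-reflexive (sym (length-· P F))) PF≤n
    F≤ : length F ≤ n ∸ length P
    F≤ = ℕ.≤-trans (ℕ.≤-reflexive (sym (ℕ.m+n∸m≡n (length P) (length F)))) (ℕ.∸-monoˡ-≤ (length P) P+F≤n)
    neg : ∀ a b → a * - b ≡ -1ℤ * (a * b)
    neg = solve-∀

  -- The divisors of P F prime to P are those of F.
  divisorSum-prime-· : ∀ {P} → Prime P → ∀ F → divisorSum (P · F) ≡ - multipleSum P F (length (P · F))
  divisorSum-prime-· {P} p F = isolate (divisorSum (P · F)) (multipleSum P F n) (begin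
    divisorSum (P · F) + multipleSum P F n
      ≡⟨ ∑-+ (upto n) _ _ ⟨
    ∑ (upto n) (λ D → ⟦ D ∣ᴹ? P · F ⟧ * liouville D + ⟦ P ∣ᴹ? D ⟧ * (⟦ D ∣ᴹ? F ⟧ * liouville D))
      ≡⟨ ∑-cong (upto n) (λ D → pointwise D (P ∣ᴹ? D)) ⟩
    ∑ (upto n) (λ D → ⟦ P ∣ᴹ? D ⟧ * (⟦ D ∣ᴹ? P · F ⟧ * liouville D) + ⟦ D ∣ᴹ? F ⟧ * liouville D)
      ≡⟨ ∑-+ (upto n) _ _ ⟩
    multipleSum P (P · F) n + ∑ (upto n) (λ D → ⟦ D ∣ᴹ? F ⟧ * liouville D)
      ≡⟨ cong₂ _+_ (multipleSum-· p F n ℕ.≤-refl) (∑-divisors-bound F n liouville (∣ᴹ⇒≤ (∣ᴹ-·ʳ F P))) ⟩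
    - divisorSum F + divisorSum F
      ≡⟨ ℤ.+-inverseˡ (divisorSum F) ⟩
    0ℤ ∎)
    where
    open ≡-Reasoning
    n = length (P · F)
    isolate : ∀ a b → a + b ≡ 0ℤ → a ≡ - b
    isolate a b e = trans (solve₁ a b) (trans (cong (_+ - b) e) (ℤ.+-identityˡ (- b)))
      where
      solve₁ : ∀ a b → a ≡ (a + b) + - b
      solve₁ = solve-∀
    coprime-part : ∀ {D} → ¬ P ∣ᴹ D → D ∣ᴹ P · F → D ∣ᴹ F
    coprime-part {D} P∤D (E , DE≡PF) with euclid D p (F , sym DE≡PF)
    ... | inj₁ P∣D          = contradiction P∣D P∤D
    ... | inj₂ (E′ , refl)  = E′ , ·-cancelˡ P (trans (trans (sym (·-assoc P D E′))
          (trans (cong (_· E′) (·-comm P D)) (·-assoc D P E′))) DE≡PF)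
    swap : ∀ a b → a + 1ℤ * b ≡ 1ℤ * a + b
    swap = solve-∀
    discard : ∀ a b c → a + 0ℤ * b ≡ 0ℤ * c + a
    discard = solve-∀
    pointwise : ∀ D (d : Dec (P ∣ᴹ D)) →
      ⟦ D ∣ᴹ? P · F ⟧ * liouville D + ⟦ d ⟧ * (⟦ D ∣ᴹ? F ⟧ * liouville D) ≡
      ⟦ d ⟧ * (⟦ D ∣ᴹ? P · F ⟧ * liouville D) + ⟦ D ∣ᴹ? F ⟧ * liouville D
    pointwise D (yes _)   = swap (⟦ D ∣ᴹ? P · F ⟧ * liouville D) (⟦ D ∣ᴹ? F ⟧ * liouville D)
    pointwise D (no P∤D)  = trans
      (discard (⟦ D ∣ᴹ? P · F ⟧ * liouville D) (⟦ D ∣ᴹ? F ⟧ * liouville D) (⟦ D ∣ᴹ? P · F ⟧ * liouville D))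
      (cong (λ e → 0ℤ * (⟦ D ∣ᴹ? P · F ⟧ * liouville D) + e * liouville D)
        (⟦⟧-cong (D ∣ᴹ? P · F) (D ∣ᴹ? F) (coprime-part P∤D) (λ D∣F → ∣ᴹ-trans D∣F (∣ᴹ-·ʳ F P))))

  divisorSum-∤ : ∀ {P} → Prime P → ∀ F → ¬ P ∣ᴹ F → divisorSum (P · F) ≡ 0ℤ
  divisorSum-∤ {P} p F P∤F = trans (divisorSum-prime-· p F)
    (cong -_ (∑-zero∈ (upto (length (P · F))) λ {D} _ → vanish D (P ∣ᴹ? D) (D ∣ᴹ? F)))
    where
    vanish : ∀ D (d : Dec (P ∣ᴹ D)) (e : Dec (D ∣ᴹ F)) → ⟦ d ⟧ * (⟦ e ⟧ * liouville D) ≡ 0ℤ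
    vanish D (no _)    e         = refl
    vanish D (yes _)   (no _)    = refl
    vanish D (yes P∣D) (yes D∣F) = contradiction (∣ᴹ-trans P∣D D∣F) P∤F

  -- The sign changes of `divisorSum-prime-·` and `multipleSum-·` cancel.
  divisorSum-P²· : ∀ {P} → Prime P → ∀ F → divisorSum (P · (P · F)) ≡ divisorSum F
  divisorSum-P²· {P} p F = trans (divisorSum-prime-· p (P · F))
    (trans (cong -_ (multipleSum-· p F _ (∣ᴹ⇒≤ (∣ᴹ-·ʳ (P · F) P)))) (ℤ.neg-involutive (divisorSum F)))

  squareRoots : Monic → ℤ
  squareRoots F = ∑ (upto (length F)) (λ R → ⟦ F ≟ᴹ R · R ⟧)

  ·-square : ∀ P S → (P · S) · (P · S) ≡ P · (P · (S · S))
  ·-square P S = trans (·-assoc P S (P · S)) (cong (P ·_)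
    (trans (sym (·-assoc S P S)) (trans (cong (_· S) (·-comm S P)) (·-assoc P S S))))

  -- P divides R R, and either outcome of `euclid` says that P divides R. With R = P S one factor P
  -- cancels.
  prime-root : ∀ {P} → Prime P → ∀ {F R} → P · F ≡ R · R → ∃ λ S → R ≡ P · S × F ≡ P · (S · S)
  prime-root {P} p {F} {R} e with reduce (euclid R p (F , e))
  ... | S , refl = S , refl , ·-cancelˡ P (trans e (·-square P S))

  squareRoots-∤ : ∀ {P} → Prime P → ∀ F → ¬ P ∣ᴹ F → squareRoots (P · F) ≡ 0ℤ
  squareRoots-∤ {P} p F P∤F = ∑-zero∈ (upto (length (P · F))) λ {R} _ → ⟦⟧-no (P · F ≟ᴹ R · R) (nosquare R)
    where
    nosquare : ∀ R → ¬ P · F ≡ R · R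
    nosquare R e with prime-root p e
    ... | S , _ , F≡ = P∤F (S · S , sym F≡)

  squareRoots-P²· : ∀ {P} → Prime P → ∀ F → squareRoots (P · (P · F)) ≡ squareRoots F
  squareRoots-P²· {P} p F = trans
    (∑-reindex _≟ᴹ_ (P ·_) (λ R → ⟦ P · (P · F) ≟ᴹ R · R ⟧) (upto! (length (P · (P · F)))) (upto! (length F))
      (λ {S} S∈ → ∈-upto _ (P · S) (begin
        length (P · S)                           ≡⟨ length-· P S ⟩
        length P ℕ.+ length S                    ≤⟨ ℕ.+-monoʳ-≤ (length P) (∈-upto⁻ (length F) S∈) ⟩
        length P ℕ.+ length F                    ≡⟨ length-· P F ⟨
        length (P · F)                           ≤⟨ ∣ᴹ⇒≤ (∣ᴹ-·ʳ (P · F) P) ⟩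
        length (P · (P · F))                     ∎))
      (λ _ _ → ·-cancelˡ P)
      (λ {R} _ → onto R (P · (P · F) ≟ᴹ R · R)))
    (∑-cong (upto (length F)) λ S → ⟦⟧-cong (P · (P · F) ≟ᴹ (P · S) · (P · S)) (F ≟ᴹ S · S) (down S) (up S))
    where
    open ℕ.≤-Reasoning
    down : ∀ S → P · (P · F) ≡ (P · S) · (P · S) → F ≡ S · S
    down S e = ·-cancelˡ P (·-cancelˡ P (trans e (·-square P S)))
    up : ∀ S → F ≡ S · S → P · (P · F) ≡ (P · S) · (P · S)
    up S e = trans (cong (λ F → P · (P · F)) e) (sym (·-square P S))
    onto : ∀ R (d : Dec (P · (P · F) ≡ R · R)) → (∃ λ S → S ∈ upto (length F) × R ≡ P · S) ⊎ ⟦ d ⟧ ≡ 0ℤ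
    onto R (no _)  = inj₂ refl
    onto R (yes e) with prime-root p e
    ... | S , R≡ , PF≡ = inj₁ (S , ∈-upto (length F) S
          (ℕ.≤-trans (∣ᴹ⇒≤ (∣ᴹ-·ʳ S S)) (ℕ.≤-reflexive (cong length (sym (·-cancelˡ P PF≡))))) , R≡)

  -- Both sides take the same value at P² F and F, and vanish at P F for P ∤ F.
  divisorSum≡squareRoots : ∀ n F → length F ≤ n → divisorSum F ≡ squareRoots F
  divisorSum≡squareRoots n [] _ = cong₂ (λ a b → a + b)
    (trans (cong₂ _*_ (⟦⟧-yes ([] ∣ᴹ? []) ∣ᴹ-refl) liouville-[]) (sym (⟦⟧-yes ([] ≟ᴹ [] · []) (sym (·-identityˡ []))))) refl
  divisorSum≡squareRoots (suc n) F@(_ ∷ _) F≤n with primeDivisor (length F) F ℕ.≤-refl (s≤s z≤n)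
  ... | P , p , G , PG≡F with P ∣ᴹ? G
  ...   | no P∤G  = subst (λ F → divisorSum F ≡ squareRoots F) PG≡F
                      (trans (divisorSum-∤ p G P∤G) (sym (squareRoots-∤ p G P∤G)))
  ...   | yes (H , refl) = subst (λ F → divisorSum F ≡ squareRoots F) PG≡F
                      (trans (divisorSum-P²· p H)
                        (trans (divisorSum≡squareRoots n H (ℕ.≤-pred (ℕ.≤-trans (shorter PG≡F) F≤n))) (sym (squareRoots-P²· p H))))
    where
    shorter : P · (P · H) ≡ F → suc (length H) ≤ length F
    shorter e = ℕ.≤-trans (ℕ.s≤s (∣ᴹ⇒≤ (∣ᴹ-·ʳ H P))) (ℕ.≤-trans (ℕ.+-monoˡ-≤ (length (P · H)) (Prime.nonunit p))
                  (ℕ.≤-reflexive (trans (sym (length-· P (P · H))) (cong length e))))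

  liouvilleSum : ℕ → ℤ
  liouvilleSum k = ∑ (words k) liouville

  -- The coefficients of L(u) / (1 - q u), where L is the series of λ. They turn out to count the
  -- monic squares of degree n, so this series is 1 / (1 - q u²).
  squareCount : ℕ → ℤ
  squareCount = conv liouvilleSum (Q ^_)

  -- The divisor sums of λ being counts of square roots, the quantity is the number of pairs (F, R)
  -- with F = R² and deg F = n. R determines F, so the R of degree n / 2 are counted; the indicator
  -- is the parity test on n.
  squareCount-closed : ∀ n → squareCount n ≡ Q ^ ⌊ n /2⌋ * ⟦ ⌊ n /2⌋ ℕ.+ ⌊ n /2⌋ ℕ.≟ n ⟧
  squareCount-closed n = begin
    squareCount n
      ≡⟨ ∑-divisor-pairs liouville n ⟨
    ∑ (words n) (λ F → ∑ (upto n) (λ D → ⟦ D ∣ᴹ? F ⟧ * liouville D))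
      ≡⟨ ∑-cong∈ (words n) (λ {F} F∈ → roots F (∈-words⁻ n F∈)) ⟩
    ∑ (words n) (λ F → ∑ (upto n) (λ R → ⟦ F ≟ᴹ R · R ⟧))
      ≡⟨ ∑-swap (words n) (upto n) (λ F R → ⟦ F ≟ᴹ R · R ⟧) ⟩
    ∑ (upto n) (λ R → ∑ (words n) (λ F → ⟦ F ≟ᴹ R · R ⟧))
      ≡⟨ ∑-cong (upto n) (λ R → count R (length R ℕ.+ length R ℕ.≟ n)) ⟩
    ∑ (upto n) (λ R → ⟦ length R ℕ.+ length R ℕ.≟ n ⟧)
      ≡⟨ ∑-⊆ _≟ᴹ_ _ (upto! n) (words! ⌊ n /2⌋)
           (λ {R} R∈ → ∈-upto n R (ℕ.≤-trans (ℕ.≤-reflexive (∈-words⁻ _ R∈)) (ℕ.⌊n/2⌋≤n n)))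
           (λ {R} _ → half R (length R ℕ.+ length R ℕ.≟ n)) ⟩
    ∑ (words ⌊ n /2⌋) (λ R → ⟦ length R ℕ.+ length R ℕ.≟ n ⟧)
      ≡⟨ ∑-cong∈ (words ⌊ n /2⌋) (λ R∈ → cong (λ k → ⟦ k ℕ.+ k ℕ.≟ n ⟧) (∈-words⁻ ⌊ n /2⌋ R∈)) ⟩
    ∑ (words ⌊ n /2⌋) (λ _ → ⟦ ⌊ n /2⌋ ℕ.+ ⌊ n /2⌋ ℕ.≟ n ⟧)
      ≡⟨ ∑-words-const ⌊ n /2⌋ _ ⟩
    Q ^ ⌊ n /2⌋ * ⟦ ⌊ n /2⌋ ℕ.+ ⌊ n /2⌋ ℕ.≟ n ⟧ ∎
    where
    open ≡-Reasoning
    roots : ∀ F → length F ≡ n → ∑ (upto n) (λ D → ⟦ D ∣ᴹ? F ⟧ * liouville D) ≡ ∑ (upto n) (λ R → ⟦ F ≟ᴹ R · R ⟧)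
    roots F refl = divisorSum≡squareRoots (length F) F ℕ.≤-refl
    count : ∀ R (d : Dec (length R ℕ.+ length R ≡ n)) → ∑ (words n) (λ F → ⟦ F ≟ᴹ R · R ⟧) ≡ ⟦ d ⟧
    count R (yes e) = trans (∑-cong (words n) λ F → sym (ℤ.*-identityʳ ⟦ F ≟ᴹ R · R ⟧))
      (∑-delta _≟ᴹ_ (λ _ → 1ℤ) (words! n) (∈-words (R · R) (trans (length-· R R) e)))
    count R (no ¬e) = ∑-zero∈ (words n) λ {F} F∈ → ⟦⟧-no (F ≟ᴹ R · R)
      λ F≡ → ¬e (trans (sym (length-· R R)) (trans (cong length (sym F≡)) (∈-words⁻ n F∈)))
    half : ∀ R (d : Dec (length R ℕ.+ length R ≡ n)) → R ∈ words ⌊ n /2⌋ ⊎ ⟦ d ⟧ ≡ 0ℤ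
    half R (yes refl) = inj₁ (∈-words R (ℕ.n≡⌊n+n/2⌋ (length R)))
    half R (no _)     = inj₂ refl

  squareCount-0 : squareCount 0 ≡ 1ℤ
  squareCount-0 = squareCount-closed 0

  squareCount-1 : squareCount 1 ≡ 0ℤ
  squareCount-1 = squareCount-closed 1

  -- The recurrence of 1 / (1 - q u²), which with the values at 0 and 1 determines the whole
  -- sequence.
  squareCount-2+ : ∀ n → squareCount (2 ℕ.+ n) ≡ Q * squareCount n
  squareCount-2+ n = begin
    squareCount (2 ℕ.+ n)                                        ≡⟨ squareCount-closed (2 ℕ.+ n) ⟩
    Q * Q ^ k * ⟦ suc k ℕ.+ suc k ℕ.≟ 2 ℕ.+ n ⟧                  ≡⟨ cong (Q * Q ^ k *_) (⟦⟧-cong (suc k ℕ.+ suc k ℕ.≟ 2 ℕ.+ n) (k ℕ.+ k ℕ.≟ n)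
        (λ e → ℕ.suc-injective (trans (sym (ℕ.+-suc k k)) (ℕ.suc-injective e)))
        (λ e → cong suc (trans (ℕ.+-suc k k) (cong suc e)))) ⟩
    Q * Q ^ k * ⟦ k ℕ.+ k ℕ.≟ n ⟧                                ≡⟨ ℤ.*-assoc Q (Q ^ k) _ ⟩
    Q * (Q ^ k * ⟦ k ℕ.+ k ℕ.≟ n ⟧)                              ≡⟨ cong (Q *_) (squareCount-closed n) ⟨
    Q * squareCount n                                            ∎
    where
    open ≡-Reasoning
    k = ⌊ n /2⌋

-- The sieve weights and the totient.

module SelbergWeights {q : ℕ} (K : FiniteField q) where
  open import Data.Integer.Base using (_+_; _*_; -_; _-_; _^_)
  open LiouvilleSums K public

  -- weight m / q is the sum over k ≤ m of the coefficients of the power series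
  -- inverse of Σ_k liouvilleSum k (u / q)^k, that is of (1 - u²/q) / (1 - u).
  weight : ℕ → ℤ
  weight zero          = Q
  weight (suc zero)    = Q + Q
  weight (suc (suc m)) = weight (suc m) + (Q - 1ℤ)

  -- Arranged as 1 + s, where s is the factor that appears in the second moment. The formula starts
  -- at degree 1: at 0 it would give q + 1, whereas `weight 0` is q.
  weight-closed : ∀ m → weight (suc m) ≡ 1ℤ + (Q + + suc m * (Q - 1ℤ))
  weight-closed zero    = shuffle Q
    where
    shuffle : ∀ Q → Q + Q ≡ 1ℤ + (Q + 1ℤ * (Q - 1ℤ))
    shuffle = solve-∀
  weight-closed (suc m) = trans (cong (_+ (Q - 1ℤ)) (weight-closed m))
    (trans (shuffle Q (+ suc m)) (cong (λ k → 1ℤ + (Q + k * (Q - 1ℤ))) (sym (ℤ.pos-+ 1 (suc m)))))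
    where
    shuffle : ∀ Q k → 1ℤ + (Q + k * (Q - 1ℤ)) + (Q - 1ℤ) ≡ 1ℤ + (Q + (1ℤ + k) * (Q - 1ℤ))
    shuffle = solve-∀

  -- Multiplying Σ λ(Y) w(m - deg Y) / |Y| by q^m gives the integral terms λ(Y)
  -- `scaledWeight (m ∸ length Y)`.
  scaledWeight : ℕ → ℤ
  scaledWeight m = Q ^ m * weight m

  -- The weight grows by q - 1 at every step but the first, where it grows by q. The term with `δ₀`
  -- is this additional 1, multiplied by q^(m+1) at m = 0.
  scaledWeight-suc : ∀ m → scaledWeight (suc m) ≡ Q * scaledWeight m + ((Q * (Q - 1ℤ)) * Q ^ m + Q * δ₀ m)
  scaledWeight-suc zero = shuffle Q
    where
    shuffle : ∀ Q → (Q * 1ℤ) * (Q + Q) ≡ Q * (1ℤ * Q) + ((Q * (Q - 1ℤ)) * 1ℤ + Q * 1ℤ)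
    shuffle = solve-∀
  scaledWeight-suc (suc m) = shuffle Q (Q ^ m) (weight (suc m))
    where
    shuffle : ∀ Q p w → (Q * (Q * p)) * (w + (Q - 1ℤ)) ≡ Q * ((Q * p) * w) + ((Q * (Q - 1ℤ)) * (Q * p) + Q * 0ℤ)
    shuffle = solve-∀

  -- By linearity the geometric part of the recurrence becomes `squareCount` and the `δ₀` part the
  -- sum of λ itself. The last summand is the boundary term, with `scaledWeight 0` = q.
  conv-scaledWeight-suc : ∀ m → conv liouvilleSum scaledWeight (suc m) ≡
    Q * conv liouvilleSum scaledWeight m + ((Q * (Q - 1ℤ)) * squareCount m + Q * liouvilleSum m) + liouvilleSum (suc m) * Q
  conv-scaledWeight-suc m = cong₂ _+_ (begin
    conv C (scaledWeight ∘ suc) m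
      ≡⟨ conv-cong C scaledWeight-suc m ⟩
    conv C (λ k → Q * scaledWeight k + ((Q * (Q - 1ℤ)) * Q ^ k + Q * δ₀ k)) m
      ≡⟨ conv-+ʳ C (λ k → Q * scaledWeight k) (λ k → (Q * (Q - 1ℤ)) * Q ^ k + Q * δ₀ k) m ⟩
    conv C (λ k → Q * scaledWeight k) m + conv C (λ k → (Q * (Q - 1ℤ)) * Q ^ k + Q * δ₀ k) m
      ≡⟨ cong₂ _+_ (conv-*ʳ C scaledWeight Q m) (conv-+ʳ C (λ k → (Q * (Q - 1ℤ)) * Q ^ k) (λ k → Q * δ₀ k) m) ⟩
    Q * conv C scaledWeight m + (conv C (λ k → (Q * (Q - 1ℤ)) * Q ^ k) m + conv C (λ k → Q * δ₀ k) m)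
      ≡⟨ cong (_+_ (Q * conv C scaledWeight m)) (cong₂ _+_ (conv-*ʳ C (Q ^_) (Q * (Q - 1ℤ)) m)
           (trans (conv-*ʳ C δ₀ Q m) (cong (Q *_) (conv-δ₀ C m)))) ⟩
    Q * conv C scaledWeight m + ((Q * (Q - 1ℤ)) * squareCount m + Q * C m) ∎)
    (cong (C (suc m) *_) (ℤ.*-identityˡ Q))
    where
    open ≡-Reasoning
    C = liouvilleSum

  liouvilleSum-suc : ∀ m → liouvilleSum (suc m) ≡ squareCount (suc m) - Q * squareCount m
  liouvilleSum-suc m = trans (shuffle (Q * squareCount m) (liouvilleSum (suc m)))
                             (cong (_- Q * squareCount m) (sym (conv-^ liouvilleSum Q m)))
    where
    shuffle : ∀ a b → b ≡ a + b - a
    shuffle = solve-∀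

  liouvilleSum-0 : liouvilleSum 0 ≡ 1ℤ
  liouvilleSum-0 = trans (sym (ℤ.*-identityʳ _)) squareCount-0

  -- The identity that dictates the weights: after division by q^m, the inner sum equals q for every
  -- m. Once the sums of λ are expressed by `squareCount`, everything except q times the previous
  -- value cancels. The cases 0 and 1 are separate because `squareCount-2+` starts at 2.
  conv-scaledWeight : ∀ m → conv liouvilleSum scaledWeight m ≡ Q ^ suc m
  conv-scaledWeight zero = trans (cong₂ _*_ liouvilleSum-0 (ℤ.*-identityˡ Q)) (ℤ.*-comm 1ℤ Q)
  conv-scaledWeight (suc zero) = begin
    conv C scaledWeight 1
      ≡⟨ conv-scaledWeight-suc 0 ⟩
    Q * conv C scaledWeight 0 + ((Q * (Q - 1ℤ)) * squareCount 0 + Q * C 0) + C 1 * Q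
      ≡⟨ cong₂ (λ c d → Q * conv C scaledWeight 0 + ((Q * (Q - 1ℤ)) * squareCount 0 + Q * c) + d * Q)
           liouvilleSum-0 (liouvilleSum-suc 0) ⟩
    Q * conv C scaledWeight 0 + ((Q * (Q - 1ℤ)) * squareCount 0 + Q * 1ℤ) + (squareCount 1 - Q * squareCount 0) * Q
      ≡⟨ cong₂ (λ a b → Q * conv C scaledWeight 0 + ((Q * (Q - 1ℤ)) * a + Q * 1ℤ) + (b - Q * a) * Q)
           squareCount-0 squareCount-1 ⟩
    Q * conv C scaledWeight 0 + ((Q * (Q - 1ℤ)) * 1ℤ + Q * 1ℤ) + (0ℤ - Q * 1ℤ) * Q
      ≡⟨ shuffle Q (conv C scaledWeight 0) ⟩
    Q * conv C scaledWeight 0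
      ≡⟨ cong (Q *_) (conv-scaledWeight 0) ⟩
    Q * Q ^ 1 ∎
    where
    open ≡-Reasoning
    C = liouvilleSum
    shuffle : ∀ Q u → Q * u + ((Q * (Q - 1ℤ)) * 1ℤ + Q * 1ℤ) + (0ℤ - Q * 1ℤ) * Q ≡ Q * u
    shuffle = solve-∀
  conv-scaledWeight (suc (suc m)) = begin
    conv C scaledWeight (2 ℕ.+ m)
      ≡⟨ conv-scaledWeight-suc (suc m) ⟩
    Q * u + ((Q * (Q - 1ℤ)) * squareCount (suc m) + Q * C (suc m)) + C (2 ℕ.+ m) * Q
      ≡⟨ cong₂ (λ c d → Q * u + ((Q * (Q - 1ℤ)) * squareCount (suc m) + Q * c) + d * Q)
           (liouvilleSum-suc m) (trans (liouvilleSum-suc (suc m)) (cong (_- Q * squareCount (suc m)) (squareCount-2+ m))) ⟩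
    _
      ≡⟨ shuffle Q u (squareCount (suc m)) (squareCount m) ⟩
    Q * u
      ≡⟨ cong (Q *_) (conv-scaledWeight (suc m)) ⟩
    Q * Q ^ suc (suc m) ∎
    where
    open ≡-Reasoning
    C = liouvilleSum
    u = conv C scaledWeight (suc m)
    shuffle : ∀ Q u b a → Q * u + ((Q * (Q - 1ℤ)) * b + Q * (b - Q * a)) + (Q * a - Q * b) * Q ≡ Q * u
    shuffle = solve-∀

  IsTotient : ℕ → (Monic → ℤ) → Set
  IsTotient z φ = ∀ X → length X ≤ z → ∑ (upto (length X)) (λ G → ⟦ G ∣ᴹ? X ⟧ * φ G) ≡ Q ^ length X

  -- Only Σ_{G ∣ X} φ(G) = q^(deg X) is needed of Euler's function, so φ is
  -- obtained by solving this relation degree by degree.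
  totient : ∀ z → ∃ (IsTotient z)
  totient zero = (λ _ → 1ℤ) , λ { [] _ → cong (λ a → a * 1ℤ + 0ℤ) (⟦⟧-yes ([] ∣ᴹ? []) ∣ᴹ-refl) }
  totient (suc z) with totient z
  ... | φ , φ-sum = φ′ , sums
    where
    new : Monic → ℤ
    new X = Q ^ length X - ∑ (upto z) (λ G → ⟦ G ∣ᴹ? X ⟧ * φ G)
    select : ∀ {X} → Dec (length X ≤ z) → ℤ
    select {X} (yes _) = φ X
    select {X} (no _)  = new X
    φ′ : Monic → ℤ
    φ′ X = select {X} (length X ℕ.≤? z)
    old≡ : ∀ {X} (d : Dec (length X ≤ z)) → length X ≤ z → select {X} d ≡ φ X
    old≡ (yes _) _ = refl
    old≡ (no ¬l) l = contradiction l ¬l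
    new≡ : ∀ {X} (d : Dec (length X ≤ z)) → length X ≡ suc z → select {X} d ≡ new X
    new≡ (yes l) e = contradiction (ℕ.≤-trans (ℕ.≤-reflexive (sym e)) l) ℕ.1+n≰n
    new≡ (no _)  _ = refl
    open ≡-Reasoning
    lower : ∀ X n → n ≤ z → ∑ (upto n) (λ G → ⟦ G ∣ᴹ? X ⟧ * φ′ G) ≡ ∑ (upto n) (λ G → ⟦ G ∣ᴹ? X ⟧ * φ G)
    lower X n n≤z = ∑-cong∈ (upto n) λ {G} G∈ →
      cong (⟦ G ∣ᴹ? X ⟧ *_) (old≡ {G} (length G ℕ.≤? z) (ℕ.≤-trans (∈-upto⁻ n G∈) n≤z))
    top : ∀ X → length X ≡ suc z → ∑ (words (suc z)) (λ G → ⟦ G ∣ᴹ? X ⟧ * φ′ G) ≡ new X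
    top X e = begin
      ∑ (words (suc z)) (λ G → ⟦ G ∣ᴹ? X ⟧ * φ′ G)
        ≡⟨ ∑-cong∈ (words (suc z)) (λ {G} G∈ → cong (_* φ′ G) (⟦⟧-cong (G ∣ᴹ? X) (G ≟ᴹ X)
             (λ G∣X → ∣ᴹ-length≡ G∣X (trans (∈-words⁻ (suc z) G∈) (sym e))) (λ G≡X → subst (_∣ᴹ X) (sym G≡X) ∣ᴹ-refl))) ⟩
      ∑ (words (suc z)) (λ G → ⟦ G ≟ᴹ X ⟧ * φ′ G)
        ≡⟨ ∑-delta _≟ᴹ_ φ′ (words! (suc z)) (∈-words X e) ⟩
      φ′ X  ≡⟨ new≡ {X} (length X ℕ.≤? z) e ⟩
      new X ∎
    sums : IsTotient (suc z) φ′
    sums X X≤ with ℕ.m≤n⇒m<n∨m≡n X≤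
    ... | inj₁ (s≤s X≤z) = trans (lower X (length X) X≤z) (φ-sum X X≤z)
    ... | inj₂ e = begin
      ∑ (upto (length X)) (λ G → ⟦ G ∣ᴹ? X ⟧ * φ′ G)
        ≡⟨ cong (λ n → ∑ (upto n) (λ G → ⟦ G ∣ᴹ? X ⟧ * φ′ G)) e ⟩
      ∑ (upto z ++ words (suc z)) (λ G → ⟦ G ∣ᴹ? X ⟧ * φ′ G)
        ≡⟨ ∑-++ (upto z) (words (suc z)) _ ⟩
      ∑ (upto z) (λ G → ⟦ G ∣ᴹ? X ⟧ * φ′ G) + ∑ (words (suc z)) (λ G → ⟦ G ∣ᴹ? X ⟧ * φ′ G)
        ≡⟨ cong₂ _+_ (lower X z ℕ.≤-refl) (top X e) ⟩
      ∑ (upto z) (λ G → ⟦ G ∣ᴹ? X ⟧ * φ G) + new X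
        ≡⟨ shuffle (∑ (upto z) (λ G → ⟦ G ∣ᴹ? X ⟧ * φ G)) (Q ^ length X) ⟩
      Q ^ length X ∎
      where
      shuffle : ∀ a b → a + (b - a) ≡ b
      shuffle = solve-∀

  module _ {z} {φ} (φ-sum : IsTotient z φ) where

    totientSum : ℕ → ℤ
    totientSum k = ∑ (words k) φ

    -- Sums the totient relation over the q^n polynomials of degree n. In terms of series, up to
    -- degree z, Φ(u) / (1 - q u) = 1 / (1 - q² u).
    conv-totientSum : ∀ n → n ≤ z → conv totientSum (Q ^_) n ≡ Q ^ n * Q ^ n
    conv-totientSum n n≤z = begin
      conv totientSum (Q ^_) n
        ≡⟨ ∑-divisor-pairs φ n ⟨
      ∑ (words n) (λ X → ∑ (upto n) (λ G → ⟦ G ∣ᴹ? X ⟧ * φ G))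
        ≡⟨ ∑-cong∈ (words n) (λ {X} X∈ → at X (∈-words⁻ n X∈)) ⟩
      ∑ (words n) (λ _ → Q ^ n)
        ≡⟨ ∑-words-const n (Q ^ n) ⟩
      Q ^ n * Q ^ n ∎
      where
      open ≡-Reasoning
      at : ∀ X → length X ≡ n → ∑ (upto n) (λ G → ⟦ G ∣ᴹ? X ⟧ * φ G) ≡ Q ^ n
      at X refl = φ-sum X n≤z

    -- Up to the factor q^(2n+1), which makes it integral, this is the sum of φ(G) / |G|² over deg G
    -- ≤ n. At n = z the last bracket is s; its initial q comes from G = 1, where φ(G) / |G|² is 1
    -- and not 1 - 1/q.
    totientSum-weighted : ∀ n → n ≤ z →
      Q * conv totientSum ((Q * Q) ^_) n ≡ (Q ^ n * Q ^ n) * (Q + + n * (Q - 1ℤ))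
    totientSum-weighted zero 0≤z = trans (cong (Q *_) (conv-totientSum 0 0≤z)) (shuffle Q)
      where
      shuffle : ∀ Q → Q * (1ℤ * 1ℤ) ≡ (1ℤ * 1ℤ) * (Q + 0ℤ * (Q - 1ℤ))
      shuffle = solve-∀
    totientSum-weighted (suc n) n<z = begin
      Q * conv Φ ((Q * Q) ^_) (suc n)
        ≡⟨ cong (Q *_) (conv-^ Φ (Q * Q) n) ⟩
      Q * ((Q * Q) * T + Φ (suc n))
        ≡⟨ cong (λ a → Q * ((Q * Q) * T + a)) Φ-suc ⟩
      Q * ((Q * Q) * T + ((Q * p) * (Q * p) - Q * (p * p)))
        ≡⟨ regroup Q T p ⟩
      (Q * Q) * (Q * T) + ((Q * p) * (Q * p)) * (Q - 1ℤ)
        ≡⟨ cong (λ a → (Q * Q) * a + ((Q * p) * (Q * p)) * (Q - 1ℤ)) (totientSum-weighted n n≤z) ⟩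
      (Q * Q) * ((p * p) * (Q + + n * (Q - 1ℤ))) + ((Q * p) * (Q * p)) * (Q - 1ℤ)
        ≡⟨ collect Q p (+ n) ⟩
      ((Q * p) * (Q * p)) * (Q + (1ℤ + + n) * (Q - 1ℤ))
        ≡⟨ cong (λ k → ((Q * p) * (Q * p)) * (Q + k * (Q - 1ℤ))) (sym (ℤ.pos-+ 1 n)) ⟩
      ((Q * p) * (Q * p)) * (Q + + suc n * (Q - 1ℤ)) ∎
      where
      open ≡-Reasoning
      n≤z = ℕ.<⇒≤ n<z
      Φ = totientSum
      T = conv Φ ((Q * Q) ^_) n
      p = Q ^ n
      isolate : ∀ a b → b ≡ a + b - a
      isolate = solve-∀
      -- Multiplication of the previous identity by 1 - q u, in coefficients.
      Φ-suc : Φ (suc n) ≡ (Q * p) * (Q * p) - Q * (p * p)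
      Φ-suc = trans (isolate (Q * conv Φ (Q ^_) n) (Φ (suc n)))
        (cong₂ _-_ (trans (sym (conv-^ Φ Q n)) (conv-totientSum (suc n) n<z)) (cong (Q *_) (conv-totientSum n n≤z)))
      regroup : ∀ Q T p → Q * ((Q * Q) * T + ((Q * p) * (Q * p) - Q * (p * p))) ≡
                          (Q * Q) * (Q * T) + ((Q * p) * (Q * p)) * (Q - 1ℤ)
      regroup = solve-∀
      collect : ∀ Q p n → (Q * Q) * ((p * p) * (Q + n * (Q - 1ℤ))) + ((Q * p) * (Q * p)) * (Q - 1ℤ) ≡
                          ((Q * p) * (Q * p)) * (Q + (1ℤ + n) * (Q - 1ℤ))
      collect = solve-∀

-- Second moment of the sieve over the interval of all `u ++ t` with `length u` = k.

module SecondMoment {q : ℕ} (K : FiniteField q) (k : ℕ) (t : List (FiniteField.Carrier K)) where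
  open import Data.Integer.Base using (_+_; _*_; -_; _-_; _^_)
  open SelbergWeights K public
  private
    module R = Monics K

  -- Averaging over all residues of degree < deg L gives the count without
  -- computing quotients, since translations permute the interval.
  interval-multiples : ∀ L → length L ≤ k →
    ∑ (words k) (λ u → ⟦ L ∣ᴹ? u ++ t ⟧) * Q ^ length L ≡ Q ^ k
  interval-multiples L L≤k = begin
    ∑ (words k) (λ u → ⟦ L ∣ᴹ? u ++ t ⟧) * Q ^ l
      ≡⟨ ℤ.*-comm _ (Q ^ l) ⟩
    Q ^ l * ∑ (words k) (λ u → ⟦ L ∣ᴹ? u ++ t ⟧)
      ≡⟨ ∑-words-const l _ ⟨
    ∑ (words l) (λ _ → ∑ (words k) (λ u → ⟦ L ∣ᴹ? u ++ t ⟧))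
      ≡⟨ ∑-cong∈ (words l) (λ {r} r∈ → translated r (r≤k r∈)) ⟩
    ∑ (words l) (λ r → ∑ (words k) (λ u → ⟦ L ∣ᴹ? (u R.- r) ++ t ⟧))
      ≡⟨ ∑-swap (words l) (words k) (λ r u → ⟦ L ∣ᴹ? (u R.- r) ++ t ⟧) ⟩
    ∑ (words k) (λ u → ∑ (words l) (λ r → ⟦ L ∣ᴹ? (u R.- r) ++ t ⟧))
      ≡⟨ ∑-cong∈ (words k) (λ {u} u∈ → residue u (∈-words⁻ k u∈)) ⟩
    ∑ (words k) (λ _ → 1ℤ)
      ≡⟨ ∑-words-1 k ⟩
    Q ^ k ∎
    where
    open ≡-Reasoning
    l = length L
    r≤k : ∀ {r} → r ∈ words l → length r ≤ k
    r≤k r∈ = ℕ.≤-trans (ℕ.≤-reflexive (∈-words⁻ l r∈)) L≤k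
    translated : ∀ r → length r ≤ k →
      ∑ (words k) (λ u → ⟦ L ∣ᴹ? u ++ t ⟧) ≡ ∑ (words k) (λ u → ⟦ L ∣ᴹ? (u R.- r) ++ t ⟧)
    translated r r≤ = ∑-reindex _≟ᴹ_ (R._- r) (λ u → ⟦ L ∣ᴹ? u ++ t ⟧) (words! k) (words! k)
      (λ {u} u∈ → ∈-words (u R.- r) (trans (length-translate u r (r≤∈ u∈)) (∈-words⁻ k u∈)))
      (λ u∈ v∈ → translate-injective r (trans (∈-words⁻ k u∈) (sym (∈-words⁻ k v∈))))
      (λ {u} u∈ → inj₁ (onto u (∈-words⁻ k u∈) (translate-surjective u r (r≤∈ u∈))))
      where
      r≤∈ : ∀ {u} → u ∈ words k → length r ≤ length u
      r≤∈ u∈ = ℕ.≤-trans r≤ (ℕ.≤-reflexive (sym (∈-words⁻ k u∈)))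
      onto : ∀ u → length u ≡ k → (∃ λ v → length v ≡ length u × u ≡ v R.- r) → ∃ λ v → v ∈ words k × u ≡ v R.- r
      onto u lu (v , lv , e) = v , ∈-words v (trans lv lu) , e
    residue : ∀ u → length u ≡ k → ∑ (words l) (λ r → ⟦ L ∣ᴹ? (u R.- r) ++ t ⟧) ≡ 1ℤ
    residue u lu = trans (∑-cong∈ (words l) λ {r} r∈ → trans
        (⟦⟧-cong (L ∣ᴹ? (u R.- r) ++ t) (r ≟ᴹ ρ) (to r r∈) (from r r∈))
        (sym (ℤ.*-identityʳ ⟦ r ≟ᴹ ρ ⟧)))
      (∑-delta _≟ᴹ_ (λ _ → 1ℤ) (words! l) (∈-words ρ (length-remainder L (poly (u ++ t)))))
      where
      ρ = remainder L (poly (u ++ t))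
      eq : ∀ r → r ∈ words l → poly ((u R.- r) ++ t) ≡ poly (u ++ t) R.- r
      eq r r∈ = poly-translate u r t (ℕ.≤-trans (r≤k r∈) (ℕ.≤-reflexive (sym lu)))
      to : ∀ r → r ∈ words l → L ∣ᴹ (u R.- r) ++ t → r ≡ ρ
      to r r∈ d = ∣ᴾ⇒remainder-≡ L (poly (u ++ t)) (∈-words⁻ l r∈) (subst (L ∣ᴾ_) (eq r r∈) (∣ᴹ⇒∣ᴾ d))
      from : ∀ r → r ∈ words l → r ≡ ρ → L ∣ᴹ (u R.- r) ++ t
      from r r∈ e = ∣ᴾ⇒∣ᴹ (subst (L ∣ᴾ_) (sym (eq r r∈)) (remainder-≡⇒∣ᴾ L (poly (u ++ t)) e))

  module _ (z : ℕ) (2z≤k : z ℕ.+ z ≤ k) where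

    φ : Monic → ℤ
    φ = proj₁ (totient z)

    coefficient : Monic → ℤ
    coefficient D = liouville D * weight (z ∸ length D)

    sieve : Monic → ℤ
    sieve F = ∑ (upto z) (λ D → ⟦ D ∣ᴹ? F ⟧ * coefficient D)

    common : Monic → Monic → ℤ
    common D E = ∑ (words k) (λ u → ⟦ D ∣ᴹ? u ++ t ⟧ * ⟦ E ∣ᴹ? u ++ t ⟧)

    -- The integral stand-in q^z / |D| for 1 / |D|.
    power : Monic → ℤ
    power D = Q ^ (z ∸ length D)

    -- The gcd couples D and E, but each of the conditions G ∣ D and G ∣ E concerns only one of
    -- them. This separation makes the quadratic form diagonal.
    gcd-totient : ∀ {D E} → (gl : GcdLcm D E) → length D ≤ z →
      Q ^ length (GcdLcm.h gl) ≡ ∑ (upto z) (λ G → φ G * (⟦ G ∣ᴹ? D ⟧ * ⟦ G ∣ᴹ? E ⟧))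
    gcd-totient {D} {E} gl D≤z = begin
      Q ^ length h
        ≡⟨ proj₂ (totient z) h h≤z ⟨
      ∑ (upto (length h)) (λ G → ⟦ G ∣ᴹ? h ⟧ * φ G)
        ≡⟨ ∑-divisors-bound h z φ h≤z ⟨
      ∑ (upto z) (λ G → ⟦ G ∣ᴹ? h ⟧ * φ G)
        ≡⟨ ∑-cong (upto z) (λ G → trans (ℤ.*-comm _ (φ G)) (cong (φ G *_) (sym (⟦⟧-× (G ∣ᴹ? D) (G ∣ᴹ? E) (G ∣ᴹ? h)
             greatest (λ G∣h → ∣ᴹ-trans G∣h h∣f , ∣ᴹ-trans G∣h h∣g))))) ⟩
      ∑ (upto z) (λ G → φ G * (⟦ G ∣ᴹ? D ⟧ * ⟦ G ∣ᴹ? E ⟧)) ∎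
      where
      open ≡-Reasoning
      open GcdLcm gl
      h≤z = ℕ.≤-trans (∣ᴹ⇒≤ h∣f) D≤z

    -- The count is q^k / |lcm| = q^k |gcd| / (|D| |E|). The factor q^(2z) turns the denominators
    -- into `power D` and `power E`.
    common-count : ∀ D E → length D ≤ z → length E ≤ z →
      (Q ^ z * Q ^ z) * common D E ≡
      (Q ^ k * (power D * power E)) * ∑ (upto z) (λ G → φ G * (⟦ G ∣ᴹ? D ⟧ * ⟦ G ∣ᴹ? E ⟧))
    common-count D E D≤z E≤z = begin
      (Q ^ z * Q ^ z) * common D E
        ≡⟨ cong₂ (λ a b → (a * b) * common D E) (split D D≤z) (split E E≤z) ⟩
      ((power D * Q ^ length D) * (power E * Q ^ length E)) * common D E
        ≡⟨ regroup₁ (power D) (Q ^ length D) (power E) (Q ^ length E) (common D E) ⟩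
      (power D * power E) * ((Q ^ length D * Q ^ length E) * common D E)
        ≡⟨ cong₂ (λ a b → (power D * power E) * (a * b)) degree-split lcm-count ⟩
      (power D * power E) * ((Q ^ length h * Q ^ length l) * ∑ (words k) (λ u → ⟦ l ∣ᴹ? u ++ t ⟧))
        ≡⟨ regroup₂ (power D * power E) (Q ^ length h) (Q ^ length l) _ ⟩
      ((∑ (words k) (λ u → ⟦ l ∣ᴹ? u ++ t ⟧) * Q ^ length l) * (power D * power E)) * Q ^ length h
        ≡⟨ cong₂ (λ a b → (a * (power D * power E)) * b) (interval-multiples l l≤k) (gcd-totient gl D≤z) ⟩
      (Q ^ k * (power D * power E)) * ∑ (upto z) (λ G → φ G * (⟦ G ∣ᴹ? D ⟧ * ⟦ G ∣ᴹ? E ⟧)) ∎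
      where
      open ≡-Reasoning
      gl = gcdLcm D E
      open GcdLcm gl
      split : ∀ F → length F ≤ z → Q ^ z ≡ power F * Q ^ length F
      split F F≤z = trans (cong (Q ^_) (sym (ℕ.m∸n+n≡m F≤z))) (ℤ.^-distribˡ-+-* Q (z ∸ length F) (length F))
      degree-split : Q ^ length D * Q ^ length E ≡ Q ^ length h * Q ^ length l
      degree-split = trans (sym (ℤ.^-distribˡ-+-* Q (length D) (length E)))
        (trans (cong (Q ^_) degrees) (ℤ.^-distribˡ-+-* Q (length h) (length l)))
      lcm-count : common D E ≡ ∑ (words k) (λ u → ⟦ l ∣ᴹ? u ++ t ⟧)
      lcm-count = ∑-cong (words k) λ u → ⟦⟧-× (D ∣ᴹ? u ++ t) (E ∣ᴹ? u ++ t) (l ∣ᴹ? u ++ t)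
        least (λ l∣ → ∣ᴹ-trans f∣l l∣ , ∣ᴹ-trans g∣l l∣)
      -- The degree of the lcm is at most deg D + deg E ≤ 2 z ≤ k, which is where the restriction on
      -- z enters.
      l≤k : length l ≤ k
      l≤k = ℕ.≤-trans (ℕ.m≤n+m (length l) (length h)) (ℕ.≤-trans (ℕ.≤-reflexive (sym degrees))
        (ℕ.≤-trans (ℕ.+-mono-≤ D≤z E≤z) 2z≤k))
      regroup₁ : ∀ a b c d e → ((a * b) * (c * d)) * e ≡ (a * c) * ((b * d) * e)
      regroup₁ = solve-∀
      regroup₂ : ∀ a b c d → a * ((b * c) * d) ≡ ((d * c) * a) * b
      regroup₂ = solve-∀

    -- With D = G Y one has z - deg D = m - deg Y and λ(D) = λ(G) λ(Y). So λ(G) comes out, and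
    -- `weight` and `power` combine to `scaledWeight`.
    diagonal : ∀ G → length G ≤ z →
      ∑ (upto z) (λ D → ⟦ G ∣ᴹ? D ⟧ * (coefficient D * power D)) ≡ liouville G * Q ^ suc (z ∸ length G)
    diagonal G G≤z = begin
      ∑ (upto z) (λ D → ⟦ G ∣ᴹ? D ⟧ * (coefficient D * power D))
        ≡⟨ ∑-multiples-upto G z (λ D → coefficient D * power D) G≤z ⟩
      ∑ (upto m) (λ Y → coefficient (G · Y) * power (G · Y))
        ≡⟨ ∑-cong (upto m) term ⟩
      ∑ (upto m) (λ Y → liouville G * (liouville Y * scaledWeight (m ∸ length Y)))
        ≡⟨ ∑-*ˡ (upto m) (liouville G) (λ Y → liouville Y * scaledWeight (m ∸ length Y)) ⟩
      liouville G * ∑ (upto m) (λ Y → liouville Y * scaledWeight (m ∸ length Y))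
        ≡⟨ cong (liouville G *_) (trans (∑-upto-conv liouville scaledWeight m) (conv-scaledWeight m)) ⟩
      liouville G * Q ^ suc m ∎
      where
      open ≡-Reasoning
      m = z ∸ length G
      regroup : ∀ g y w p → ((g * y) * w) * p ≡ g * (y * (p * w))
      regroup = solve-∀
      term : ∀ Y → coefficient (G · Y) * power (G · Y) ≡ liouville G * (liouville Y * scaledWeight (m ∸ length Y))
      term Y = trans
        (cong₂ (λ a n → (a * weight n) * Q ^ n) (liouville-· G Y)
          (trans (cong (z ∸_) (length-· G Y)) (sym (ℕ.∸-+-assoc z (length G) (length Y)))))
        (regroup (liouville G) (liouville Y) (weight (m ∸ length Y)) (Q ^ (m ∸ length Y)))

    secondMoment-expand :
      ∑ (words k) (λ u → sieve (u ++ t) * sieve (u ++ t)) ≡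
      ∑ (upto z) (λ D → ∑ (upto z) (λ E → (coefficient D * coefficient E) * common D E))
    secondMoment-expand = begin
      ∑ (words k) (λ u → sieve (u ++ t) * sieve (u ++ t))
        ≡⟨ ∑-cong (words k) (λ u → ∑-square (upto z) (λ D → ⟦ D ∣ᴹ? u ++ t ⟧ * coefficient D)) ⟩
      ∑ (words k) (λ u → ∑ (upto z) (λ D → ∑ (upto z) (λ E → term u D E)))
        ≡⟨ ∑-swap (words k) (upto z) (λ u D → ∑ (upto z) (term u D)) ⟩
      ∑ (upto z) (λ D → ∑ (words k) (λ u → ∑ (upto z) (λ E → term u D E)))
        ≡⟨ ∑-cong (upto z) (λ D → ∑-swap (words k) (upto z) (λ u E → term u D E)) ⟩
      ∑ (upto z) (λ D → ∑ (upto z) (λ E → ∑ (words k) (λ u → term u D E)))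
        ≡⟨ ∑-cong (upto z) (λ D → ∑-cong (upto z) (collect D)) ⟩
      ∑ (upto z) (λ D → ∑ (upto z) (λ E → (coefficient D * coefficient E) * common D E)) ∎
      where
      open ≡-Reasoning
      term : Monic → Monic → Monic → ℤ
      term u D E = (⟦ D ∣ᴹ? u ++ t ⟧ * coefficient D) * (⟦ E ∣ᴹ? u ++ t ⟧ * coefficient E)
      regroup : ∀ a b c d → (a * b) * (c * d) ≡ (b * d) * (a * c)
      regroup = solve-∀
      collect : ∀ D E → ∑ (words k) (λ u → term u D E) ≡ (coefficient D * coefficient E) * common D E
      collect D E = trans
        (∑-cong (words k) λ u → regroup ⟦ D ∣ᴹ? u ++ t ⟧ (coefficient D) ⟦ E ∣ᴹ? u ++ t ⟧ (coefficient E))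
        (∑-*ˡ (words k) (coefficient D * coefficient E) (λ u → ⟦ D ∣ᴹ? u ++ t ⟧ * ⟦ E ∣ᴹ? u ++ t ⟧))

    -- After `common-count` each summand is a product y(G, D) y(G, E) with a factor depending on G.
    -- Moving the sum over G outside leaves the square of the `diagonal` sum, in which λ(G)² = 1.
    secondMoment-diagonalised :
      (Q ^ z * Q ^ z) * ∑ (words k) (λ u → sieve (u ++ t) * sieve (u ++ t)) ≡
      (Q ^ k * (Q * Q)) * conv (totientSum {z} {φ} (proj₂ (totient z))) ((Q * Q) ^_) z
    secondMoment-diagonalised = begin
      P * ∑ (words k) (λ u → sieve (u ++ t) * sieve (u ++ t))
        ≡⟨ cong (P *_) secondMoment-expand ⟩
      P * ∑ (upto z) (λ D → ∑ (upto z) (λ E → (x D * x E) * common D E))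
        ≡⟨ ∑-*ˡ (upto z) P (λ D → ∑ (upto z) (λ E → (x D * x E) * common D E)) ⟨
      ∑ (upto z) (λ D → P * ∑ (upto z) (λ E → (x D * x E) * common D E))
        ≡⟨ ∑-cong (upto z) (λ D → ∑-*ˡ (upto z) P (λ E → (x D * x E) * common D E)) ⟨
      ∑ (upto z) (λ D → ∑ (upto z) (λ E → P * ((x D * x E) * common D E)))
        ≡⟨ ∑-cong∈ (upto z) (λ {D} D∈ → ∑-cong∈ (upto z) (λ {E} E∈ → term D E (∈-upto⁻ z D∈) (∈-upto⁻ z E∈))) ⟩
      ∑ (upto z) (λ D → ∑ (upto z) (λ E → ∑ (upto z) (λ G → Q ^ k * (φ G * (y G D * y G E)))))
        ≡⟨ ∑-cong (upto z) (λ D → ∑-swap (upto z) (upto z) (λ E G → Q ^ k * (φ G * (y G D * y G E)))) ⟩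
      ∑ (upto z) (λ D → ∑ (upto z) (λ G → ∑ (upto z) (λ E → Q ^ k * (φ G * (y G D * y G E)))))
        ≡⟨ ∑-swap (upto z) (upto z) (λ D G → ∑ (upto z) (λ E → Q ^ k * (φ G * (y G D * y G E)))) ⟩
      ∑ (upto z) (λ G → ∑ (upto z) (λ D → ∑ (upto z) (λ E → Q ^ k * (φ G * (y G D * y G E)))))
        ≡⟨ ∑-cong∈ (upto z) (λ {G} G∈ → square G (∈-upto⁻ z G∈)) ⟩
      ∑ (upto z) (λ G → (Q ^ k * (Q * Q)) * (φ G * (Q * Q) ^ (z ∸ length G)))
        ≡⟨ ∑-*ˡ (upto z) (Q ^ k * (Q * Q)) (λ G → φ G * (Q * Q) ^ (z ∸ length G)) ⟩
      (Q ^ k * (Q * Q)) * ∑ (upto z) (λ G → φ G * (Q * Q) ^ (z ∸ length G))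
        ≡⟨ cong ((Q ^ k * (Q * Q)) *_) (∑-upto-conv φ ((Q * Q) ^_) z) ⟩
      (Q ^ k * (Q * Q)) * conv (λ n → ∑ (words n) φ) ((Q * Q) ^_) z ∎
      where
      open ≡-Reasoning
      P = Q ^ z * Q ^ z
      x = coefficient
      y : Monic → Monic → ℤ
      y G D = ⟦ G ∣ᴹ? D ⟧ * (x D * power D)
      pull : ∀ P a c → P * (a * c) ≡ a * (P * c)
      pull = solve-∀
      regroup : ∀ d e K p r f a b → (d * e) * ((K * (p * r)) * (f * (a * b))) ≡ K * (f * ((a * (d * p)) * (b * (e * r))))
      regroup = solve-∀
      term : ∀ D E → length D ≤ z → length E ≤ z →
        P * ((x D * x E) * common D E) ≡ ∑ (upto z) (λ G → Q ^ k * (φ G * (y G D * y G E)))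
      term D E D≤z E≤z = begin
        P * ((x D * x E) * common D E)
          ≡⟨ pull P (x D * x E) (common D E) ⟩
        (x D * x E) * (P * common D E)
          ≡⟨ cong ((x D * x E) *_) (common-count D E D≤z E≤z) ⟩
        (x D * x E) * (c * ∑ (upto z) (λ G → g G))
          ≡⟨ cong ((x D * x E) *_) (∑-*ˡ (upto z) c g) ⟨
        (x D * x E) * ∑ (upto z) (λ G → c * g G)
          ≡⟨ ∑-*ˡ (upto z) (x D * x E) (λ G → c * g G) ⟨
        ∑ (upto z) (λ G → (x D * x E) * (c * g G))
          ≡⟨ ∑-cong (upto z) (λ G → regroup (x D) (x E) (Q ^ k) (power D) (power E) (φ G) ⟦ G ∣ᴹ? D ⟧ ⟦ G ∣ᴹ? E ⟧) ⟩
        ∑ (upto z) (λ G → Q ^ k * (φ G * (y G D * y G E))) ∎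
        where
        c = Q ^ k * (power D * power E)
        g : Monic → ℤ
        g G = φ G * (⟦ G ∣ᴹ? D ⟧ * ⟦ G ∣ᴹ? E ⟧)
      square-^ : ∀ m → (Q ^ m) * (Q ^ m) ≡ (Q * Q) ^ m
      square-^ zero    = refl
      square-^ (suc m) = trans (interchange Q (Q ^ m)) (cong ((Q * Q) *_) (square-^ m))
        where
        interchange : ∀ a b → (a * b) * (a * b) ≡ (a * a) * (b * b)
        interchange = solve-∀
      finish : ∀ K f l p Q → K * (f * ((l * (Q * p)) * (l * (Q * p)))) ≡ (K * (Q * Q)) * (f * ((l * l) * (p * p)))
      finish = solve-∀
      square : ∀ G → length G ≤ z →
        ∑ (upto z) (λ D → ∑ (upto z) (λ E → Q ^ k * (φ G * (y G D * y G E)))) ≡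
        (Q ^ k * (Q * Q)) * (φ G * (Q * Q) ^ (z ∸ length G))
      square G G≤z = begin
        ∑ (upto z) (λ D → ∑ (upto z) (λ E → Q ^ k * (φ G * (y G D * y G E))))
          ≡⟨ ∑-cong (upto z) (λ D → trans (∑-*ˡ (upto z) (Q ^ k) (λ E → φ G * (y G D * y G E)))
               (cong (Q ^ k *_) (∑-*ˡ (upto z) (φ G) (λ E → y G D * y G E)))) ⟩
        ∑ (upto z) (λ D → Q ^ k * (φ G * ∑ (upto z) (λ E → y G D * y G E)))
          ≡⟨ trans (∑-*ˡ (upto z) (Q ^ k) (λ D → φ G * ∑ (upto z) (λ E → y G D * y G E)))
               (cong (Q ^ k *_) (∑-*ˡ (upto z) (φ G) (λ D → ∑ (upto z) (λ E → y G D * y G E)))) ⟩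
        Q ^ k * (φ G * ∑ (upto z) (λ D → ∑ (upto z) (λ E → y G D * y G E)))
          ≡⟨ cong (λ s → Q ^ k * (φ G * s)) (∑-square (upto z) (y G)) ⟨
        Q ^ k * (φ G * (∑ (upto z) (y G) * ∑ (upto z) (y G)))
          ≡⟨ cong (λ s → Q ^ k * (φ G * (s * s))) (diagonal G G≤z) ⟩
        Q ^ k * (φ G * ((liouville G * (Q * p)) * (liouville G * (Q * p))))
          ≡⟨ finish (Q ^ k) (φ G) (liouville G) p Q ⟩
        (Q ^ k * (Q * Q)) * (φ G * ((liouville G * liouville G) * (p * p)))
          ≡⟨ cong₂ (λ a b → (Q ^ k * (Q * Q)) * (φ G * (a * b))) (liouville-square G) (square-^ (z ∸ length G)) ⟩
        (Q ^ k * (Q * Q)) * (φ G * (1ℤ * (Q * Q) ^ (z ∸ length G)))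
          ≡⟨ cong (λ a → (Q ^ k * (Q * Q)) * (φ G * a)) (ℤ.*-identityˡ _) ⟩
        (Q ^ k * (Q * Q)) * (φ G * (Q * Q) ^ (z ∸ length G)) ∎
        where p = Q ^ (z ∸ length G)

    -- One more factor q makes `totientSum-weighted` applicable; then q^(2z+1) is cancelled, which
    -- is possible since q is not 0.
    secondMoment : .{{ℕ.NonZero q}} →
      ∑ (words k) (λ u → sieve (u ++ t) * sieve (u ++ t)) ≡ (Q ^ k * Q) * (Q + + z * (Q - 1ℤ))
    secondMoment {{q≢0}} = ℤ.*-cancelˡ-≡ (Q * (Q ^ z * Q ^ z)) _ _ {{nz}} (begin
      (Q * P) * M                                    ≡⟨ ℤ.*-assoc Q P M ⟩
      Q * (P * M)                                    ≡⟨ cong (Q *_) secondMoment-diagonalised ⟩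
      Q * ((Q ^ k * (Q * Q)) * T)                    ≡⟨ regroup₁ Q (Q ^ k * (Q * Q)) T ⟩
      (Q ^ k * (Q * Q)) * (Q * T)                    ≡⟨ cong ((Q ^ k * (Q * Q)) *_) (totientSum-weighted (proj₂ (totient z)) z ℕ.≤-refl) ⟩
      (Q ^ k * (Q * Q)) * (P * (Q + + z * (Q - 1ℤ))) ≡⟨ regroup₂ (Q ^ k) Q P (Q + + z * (Q - 1ℤ)) ⟩
      (Q * P) * ((Q ^ k * Q) * (Q + + z * (Q - 1ℤ))) ∎)
      where
      open ≡-Reasoning
      P = Q ^ z * Q ^ z
      M = ∑ (words k) (λ u → sieve (u ++ t) * sieve (u ++ t))
      T = conv (totientSum (proj₂ (totient z))) ((Q * Q) ^_) z
      regroup₁ : ∀ a b c → a * (b * c) ≡ b * (a * c)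
      regroup₁ = solve-∀
      regroup₂ : ∀ K Q P s → (K * (Q * Q)) * (P * s) ≡ (Q * P) * ((K * Q) * s)
      regroup₂ = solve-∀
      nz^ : ∀ n → ℤ.NonZero (Q ^ n)
      nz^ zero    = _
      nz^ (suc n) = ℤ.i*j≢0 Q (Q ^ n) {{q≢0}} {{nz^ n}}
      nz : ℤ.NonZero (Q * (Q ^ z * Q ^ z))
      nz = ℤ.i*j≢0 Q (Q ^ z * Q ^ z) {{q≢0}} {{ℤ.i*j≢0 (Q ^ z) (Q ^ z) {{nz^ z}} {{nz^ z}}}}

-- Least prime divisors and rough polynomials.

module Roughness {q : ℕ} (K : FiniteField q) where
  open Liouville K
  open Monics K using (_+_; _*_; -_; _-_; module F)
  open FiniteField K using (inverse)

  -- A nonunit divisor of least degree is automatically irreducible, so it attains the minimum in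
  -- the definition of P⁻.
  record LeastDivisor (F : Monic) : Set where
    field
      P       : Monic
      P∣F     : P ∣ᴹ F
      nonunit : 1 ≤ length P
      least   : ∀ {D} → D ∣ᴹ F → 1 ≤ length D → length P ≤ length D

  leastDivisor : ∀ F → 1 ≤ length F → LeastDivisor F
  leastDivisor F 1≤F = go (length F) F ℕ.≤-refl ∣ᴹ-refl 1≤F
    where
    go : ∀ n P → length P ≤ n → P ∣ᴹ F → 1 ≤ length P → LeastDivisor F
    go zero    P P≤0 _   1≤P = contradiction (ℕ.≤-trans 1≤P P≤0) λ ()
    go (suc n) P P≤n P∣F 1≤P
      with any? (λ D → D ∣ᴹ? F ×-dec ((1 ℕ.≤? length D) ×-dec (length D ℕ.<? length P))) (upto (length F))
    ... | yes found with find found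
    ...   | D , _ , D∣F , 1≤D , D<P = go n D (ℕ.≤-pred (ℕ.≤-trans D<P P≤n)) D∣F 1≤D
    go (suc n) P P≤n P∣F 1≤P | no none = record
      { P = P ; P∣F = P∣F ; nonunit = 1≤P
      ; least = λ {D} D∣F 1≤D → ℕ.≮⇒≥ λ D<P →
          none (lose (∈-upto (length F) D (∣ᴹ⇒≤ D∣F)) (D∣F , 1≤D , D<P)) }

  ∣⇒∣ᴾ : ∀ {f G X} → poly f ≋ X → X ∣ G → f ∣ᴾ G
  ∣⇒∣ᴾ {f} e (Y , eq) = Y , ≋-trans (*-cong e ≋-refl) (≋-trans (*-comm _ Y) (≈⇒≋ eq))

  ∣ᴾ⇒∣ : ∀ {f G} → f ∣ᴾ G → poly f ∣ G
  ∣ᴾ⇒∣ {f} (Y , e) = Y , ≋⇒≈ (≋-trans (*-comm Y (poly f)) e)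

  unit-∣1 : ∀ {X c} → c ≢ F.0# → X ≋ c ⋆ poly [] → X ∣ (F.1# ∷ [])
  unit-∣1 {X} {c} c≢0 e = c⁻¹ ⋆ poly [] , ≋⇒≈ (begin
    (c⁻¹ ⋆ poly []) * X           ≈⟨ *-congˡ (c⁻¹ ⋆ poly []) e ⟩
    (c⁻¹ ⋆ poly []) * (c ⋆ poly []) ≈⟨ *-⋆ c (c⁻¹ ⋆ poly []) (poly []) ⟩
    c ⋆ ((c⁻¹ ⋆ poly []) * poly []) ≈⟨ ⋆-cong refl (≋-trans (⋆-* c⁻¹ (poly []) (poly [])) (⋆-cong refl (*-identityˡ (poly [])))) ⟩
    c ⋆ (c⁻¹ ⋆ poly [])           ≈⟨ ⋆-⋆ c c⁻¹ (poly []) ⟩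
    (c F.* c⁻¹) ⋆ poly []         ≈⟨ ⋆-cong (proj₂ (inverse c c≢0)) ≋-refl ⟩
    F.1# ⋆ poly []                ≈⟨ 1⋆ (poly []) ⟩
    poly []                       ∎)
    where
    open import Relation.Binary.Reasoning.Setoid ≋-setoid
    c⁻¹ = proj₁ (inverse c c≢0)

  zero-product : ∀ {f X Y} → poly f ≋ X * Y → ¬ X ≋ []
  zero-product {f} e X≋0 = poly≉0 f (≋-trans e (*-cong X≋0 ≋-refl))

  -- A factor f of P of positive degree also divides F, so deg f ≥ deg P, which leaves no room for a
  -- second factor of positive degree. Proving only that f g divides P spares the computation of the
  -- scalars.
  least⇒irreducible : ∀ {F} (d : LeastDivisor F) → Irreducible (poly (LeastDivisor.P d))
  least⇒irreducible {F} d = mkIrred ¬unit split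
    where
    open LeastDivisor d
    ¬unit : ¬ poly P ∣ (F.1# ∷ [])
    ¬unit P∣1 = contradiction (ℕ.≤-trans nonunit (∣ᴹ⇒≤ (∣ᴾ⇒∣ᴹ {P} {[]} (∣⇒∣ᴾ ≋-refl P∣1)))) λ ()
    split : ∀ {X Y} → poly P ≈ X * Y → X ∣ (F.1# ∷ []) ⊎ Y ∣ (F.1# ∷ [])
    split {X} {Y} e with normalise X | normalise Y
    ... | inj₁ X≋0 | _        = contradiction X≋0 (zero-product {P} {X} {Y} (≈⇒≋ e))
    ... | inj₂ _   | inj₁ Y≋0 = contradiction Y≋0 (zero-product {P} {Y} {X} (≋-trans (≈⇒≋ e) (*-comm X Y)))
    ... | inj₂ (c , f , c≢0 , X≋ , _) | inj₂ (b , g , b≢0 , Y≋ , _) with length f in lf | length g in lg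
    ...   | zero  | _     = inj₁ (unit-∣1 c≢0 (subst (λ f → X ≋ c ⋆ poly f) (length≡0 lf) X≋))
    ...   | suc _ | zero  = inj₂ (unit-∣1 b≢0 (subst (λ g → Y ≋ b ⋆ poly g) (length≡0 lg) Y≋))
    ...   | suc _ | suc _ = contradiction fg≤P (ℕ.<⇒≱ (begin-strict
      length P              ≤⟨ least (∣ᴹ-trans (∣ᴹ-trans (g , refl) fg∣P) P∣F) (ℕ.≤-trans (s≤s z≤n) (ℕ.≤-reflexive (sym lf))) ⟩
      length f              <⟨ ℕ.m<m+n (length f) (ℕ.≤-trans (s≤s z≤n) (ℕ.≤-reflexive (sym lg))) ⟩
      length f ℕ.+ length g ≡⟨ length-· f g ⟨
      length (f · g)        ∎))
      where
      open ℕ.≤-Reasoning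
      fg∣P : f · g ∣ᴹ P
      fg∣P = ∣ᴾ⇒∣ᴹ {f · g} {P} (b ⋆ (c ⋆ poly []) , (R.begin
        poly (f · g) * (b ⋆ (c ⋆ poly []))   R.≈⟨ *-⋆ b (poly (f · g)) (c ⋆ poly []) ⟩
        b ⋆ (poly (f · g) * (c ⋆ poly []))   R.≈⟨ ⋆-cong refl (*-⋆ c (poly (f · g)) (poly [])) ⟩
        b ⋆ (c ⋆ (poly (f · g) * poly []))   R.≈⟨ ⋆-cong refl (⋆-cong refl (≋-trans (*-comm (poly (f · g)) (poly [])) (*-identityˡ _))) ⟩
        b ⋆ (c ⋆ poly (f · g))               R.≈⟨ ⋆-cong refl (⋆-cong refl (poly-· f g)) ⟩
        b ⋆ (c ⋆ (poly f * poly g))          R.≈⟨ ⋆-cong refl (⋆-* c (poly f) (poly g)) ⟨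
        b ⋆ ((c ⋆ poly f) * poly g)          R.≈⟨ *-⋆ b (c ⋆ poly f) (poly g) ⟨
        (c ⋆ poly f) * (b ⋆ poly g)          R.≈⟨ *-cong X≋ Y≋ ⟨
        X * Y                                R.≈⟨ ≈⇒≋ e ⟨
        poly P                               R.∎))
        where module R = Relation.Binary.Reasoning.Setoid ≋-setoid
      fg≤P : length (f · g) ≤ length P
      fg≤P = ∣ᴹ⇒≤ fg∣P

  module _ {F X} (F≋X : poly F ≋ X) (1≤F : 1 ≤ length F) where
    open LeastDivisor (leastDivisor F 1≤F)

    leastDivisor-prime : PrimeDivisorDegree X (length P)
    leastDivisor-prime = poly P , 𝓜-poly P , least⇒irreducible (leastDivisor F 1≤F) ,
      ∣ᴾ⇒∣ {P} (∣ᴾ-resp {P} F≋X (∣ᴹ⇒∣ᴾ P∣F))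

    leastDivisor-least : ∀ n → PrimeDivisorDegree X n → length P ≤ n
    leastDivisor-least n (Y , monic , mkIrred Y∤1 _ , Y∣X) = ℕ.≤-trans
      (least (∣ᴾ⇒∣ᴹ {D} {F} (∣ᴾ-resp {D} (≋-sym F≋X) (∣⇒∣ᴾ (poly-code monic) Y∣X))) 1≤D)
      (ℕ.≤-reflexive (length-code n Y))
      where
      D = code n Y
      1≤D : 1 ≤ length D
      1≤D with length D in lD
      ... | suc _ = s≤s z≤n
      -- In degree 0 the monic Y would be 1, which is a unit.
      ... | zero  = ⊥-elim (Y∤1 (F.1# ∷ [] , ≋⇒≈ (≋-trans (*-identityˡ Y)
              (≋-trans (≋-sym (poly-code monic)) (subst (λ D → poly D ≋ F.1# ∷ []) (sym (length≡0 lD)) ≋-refl)))))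

    smallestPrimeDegree : P⁻ X ≡ length P
    smallestPrimeDegree = leastDivisor-prime , leastDivisor-least

  -- Phrased with all nonunit divisors of degree at most z: over the finite list this is decidable,
  -- and it leaves D = 1 as the only nonzero term of the sieve.
  Rough : ℕ → Monic → Set
  Rough z F = All (λ D → ¬ (D ∣ᴹ F × 1 ≤ length D)) (upto z)

  rough? : ∀ z F → Dec (Rough z F)
  rough? z F = all? (λ D → ¬? (D ∣ᴹ? F ×-dec (1 ℕ.≤? length D))) (upto z)

  -- Positive degree matters: P⁻ > z asserts that a least prime degree exists, and 1 has none.
  rough⇒P⁻> : ∀ {z F X} → poly F ≋ X → 1 ≤ length F → Rough z F → P⁻ X > z
  rough⇒P⁻> {z} {F} F≋X 1≤F rough = length P , smallestPrimeDegree F≋X 1≤F ,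
    ℕ.≰⇒> λ P≤z → All.lookup rough (∈-upto z P P≤z) (P∣F , nonunit)
    where open LeastDivisor (leastDivisor F 1≤F)

  P⁻>⇒rough : ∀ {z F X} → poly F ≋ X → 1 ≤ length F → P⁻ X > z → Rough z F
  P⁻>⇒rough {z} {F} F≋X 1≤F (m , (_ , m-least) , z<m) = All.tabulate λ {D} D∈ (D∣F , 1≤D) →
    ℕ.<⇒≱ z<m (ℕ.≤-trans (m-least _ (leastDivisor-prime F≋X 1≤F)) (ℕ.≤-trans (least D∣F 1≤D) (∈-upto⁻ z D∈)))
    where open LeastDivisor (leastDivisor F 1≤F)

-- Elementary inequalities and the passage to rationals.

≤-÷ : ∀ {p x} y .{{_ : ℚ.NonZero y}} .{{_ : ℚ.Positive y}} → p ℚ.* y ℚ.≤ x → p ℚ.≤ x ÷ y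
≤-÷ {p} {x@record{}} y@record{} py≤x = ℚ.*-cancelʳ-≤-pos y (begin
  p ℚ.* y              ≤⟨ py≤x ⟩
  x                    ≃⟨ ℚ.*-identityʳ x ⟨
  x ℚ.* ℚ.1ℚᵘ          ≃⟨ ℚ.*-congˡ {x} (ℚ.*-inverseˡ y) ⟨
  x ℚ.* (1/ y ℚ.* y)   ≃⟨ ℚ.*-assoc x (1/ y) y ⟨
  (x ÷ y) ℚ.* y        ∎)
  where open ℚ.≤-Reasoning

-- Rests on x / (z (1 - 1/q)) = x q / (z (q - 1)). The stray factors 1 are denominators from the
-- cross multiplication of unnormalised fractions.
density-bound : ∀ c x z q .{{_ : NonZero z}} .{{_ : NonTrivial q}} →
  + c ℤ.* (+ z ℤ.* (+ q ℤ.- 1ℤ)) ℤ.≤ + x ℤ.* + q →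
  (+ c / 1) ℚ.≤ (+ x / 1) ÷ (z ·[1-1/ q ])
density-bound c x z@(suc _) q@(2+ _) bound = ≤-÷ {+ c / 1} {+ x / 1} (z ·[1-1/ q ]) (ℚ.*≤* (subst₂ ℤ._≤_
  (lhs (+ c) (+ z) (+ q)) (trans (sym (ℤ.pos-* x q)) (trans (cong +_ (rhs x q)) (ℤ.pos-* x (1 ℕ.* (1 ℕ.* (1 ℕ.* q)))))) bound))
  where
  lhs : ∀ c z q → c ℤ.* (z ℤ.* (q ℤ.- 1ℤ)) ≡ (c ℤ.* (z ℤ.* (1ℤ ℤ.* q ℤ.+ -1ℤ ℤ.* 1ℤ))) ℤ.* 1ℤ
  lhs = solve-∀
  rhs : ∀ x q → x ℕ.* q ≡ x ℕ.* (1 ℕ.* (1 ℕ.* (1 ℕ.* q)))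
  rhs x q = cong (x ℕ.*_) (sym (trans (ℕ.*-identityˡ _) (trans (ℕ.*-identityˡ _) (ℕ.*-identityˡ q))))

-- Lowering (1 + s)² to s² lets one s cancel, and lowering s to t then gives the bound. In the
-- application s = q + t with t = z (q - 1).
drop-square : ∀ c M s t → 0ℤ ℤ.< s → 0ℤ ℤ.≤ c → t ℤ.≤ s →
  c ℤ.* ((1ℤ ℤ.+ s) ℤ.* (1ℤ ℤ.+ s)) ℤ.≤ M ℤ.* s → c ℤ.* t ℤ.≤ M
drop-square c M s t 0<s 0≤c t≤s bound = ℤ.≤-trans
  (ℤ.*-monoˡ-≤-nonNeg c {{ℤ.nonNegative 0≤c}} t≤s)
  (ℤ.*-cancelʳ-≤-pos (c ℤ.* s) M s {{ℤ.positive 0<s}} (begin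
    (c ℤ.* s) ℤ.* s                        ≡⟨ ℤ.*-assoc c s s ⟩
    c ℤ.* (s ℤ.* s)                        ≤⟨ ℤ.*-monoˡ-≤-nonNeg c {{ℤ.nonNegative 0≤c}} square≤ ⟩
    c ℤ.* ((1ℤ ℤ.+ s) ℤ.* (1ℤ ℤ.+ s))      ≤⟨ bound ⟩
    M ℤ.* s                                ∎))
  where
  open ℤ.≤-Reasoning
  0≤s = ℤ.<⇒≤ 0<s
  s≤1+s = ℤ.i≤j+i s 1ℤ
  square≤ : s ℤ.* s ℤ.≤ (1ℤ ℤ.+ s) ℤ.* (1ℤ ℤ.+ s)
  square≤ = ℤ.≤-trans (ℤ.*-monoˡ-≤-nonNeg s {{ℤ.nonNegative 0≤s}} s≤1+s)
                      (ℤ.*-monoʳ-≤-nonNeg (1ℤ ℤ.+ s) {{ℤ.nonNegative (ℤ.≤-trans 0≤s s≤1+s)}} s≤1+s)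

pos-^ : ∀ q n → + (q ℕ.^ n) ≡ (+ q) ℤ.^ n
pos-^ q zero    = refl
pos-^ q (suc n) = trans (ℤ.pos-* q (q ℕ.^ n)) (cong (+ q ℤ.*_) (pos-^ q n))

square-nonNeg : ∀ i → 0ℤ ℤ.≤ i ℤ.* i
square-nonNeg (+ n)        = subst (0ℤ ℤ.≤_) (ℤ.pos-* n n) (+≤+ z≤n)
square-nonNeg ℤ.-[1+ n ]   = +≤+ z≤n

drop-applyUpTo : ∀ {A : Set} {f g : ℕ → A} k n → (∀ i → k ≤ i → f i ≡ g i) →
                 drop k (applyUpTo f n) ≡ drop k (applyUpTo g n)
drop-applyUpTo zero    zero    e = refl
drop-applyUpTo zero    (suc n) e = cong₂ _∷_ (e 0 z≤n) (drop-applyUpTo 0 n λ i _ → e (suc i) z≤n)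
drop-applyUpTo (suc k) zero    e = refl
drop-applyUpTo (suc k) (suc n) e = drop-applyUpTo k n λ i k≤i → e (suc i) (s≤s k≤i)

-- The sieve bound for the interval.

module RoughInterval {q : ℕ} .{{q>1 : NonTrivial q}} (K : FiniteField q) (k : ℕ)
                     (t : List (FiniteField.Carrier K)) (z : ℕ) where
  open SecondMoment K k t
  open Roughness K

  roughs : List Monic
  roughs = filter (λ u → rough? z (u ++ t)) (words k)

  module _ (2z≤k : z ℕ.+ z ≤ k) where

    sieve-rough : ∀ {F} → Rough z F → sieve z 2z≤k F ≡ weight z
    sieve-rough {F} rough = begin
      sieve z 2z≤k F
        ≡⟨ ∑-⊆ _≟ᴹ_ (λ D → ⟦ D ∣ᴹ? F ⟧ ℤ.* coefficient z 2z≤k D) (upto! z) (words! 0)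
             (λ {D} D∈ → ∈-upto z D (ℕ.≤-trans (ℕ.≤-reflexive (∈-words⁻ 0 D∈)) z≤n))
             (λ {D} D∈ → unit D∈ (D ∣ᴹ? F)) ⟩
      ⟦ [] ∣ᴹ? F ⟧ ℤ.* (liouville [] ℤ.* weight z) ℤ.+ 0ℤ
        ≡⟨ cong₂ (λ a b → a ℤ.* (b ℤ.* weight z) ℤ.+ 0ℤ) (⟦⟧-yes ([] ∣ᴹ? F) (F , ·-identityˡ F)) liouville-[] ⟩
      1ℤ ℤ.* (1ℤ ℤ.* weight z) ℤ.+ 0ℤ
        ≡⟨ shuffle (weight z) ⟩
      weight z ∎
      where
      open ≡-Reasoning
      shuffle : ∀ w → 1ℤ ℤ.* (1ℤ ℤ.* w) ℤ.+ 0ℤ ≡ w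
      shuffle = solve-∀
      unit : ∀ {D} → D ∈ upto z → (d : Dec (D ∣ᴹ F)) → D ∈ words 0 ⊎ ⟦ d ⟧ ℤ.* coefficient z 2z≤k D ≡ 0ℤ
      unit {[]}    D∈ (yes _)   = inj₁ (here refl)
      unit {_ ∷ _} D∈ (yes D∣F) = contradiction (D∣F , s≤s z≤n) (All.lookup rough D∈)
      unit         D∈ (no _)    = inj₂ refl

    rough-count : .{{NonZero z}} → + length roughs ℤ.* (+ z ℤ.* (Q ℤ.- 1ℤ)) ℤ.≤ + (q ℕ.^ k) ℤ.* Q
    rough-count = drop-square (+ length roughs) (+ (q ℕ.^ k) ℤ.* Q) s (+ z ℤ.* (Q ℤ.- 1ℤ))
      0<s (+≤+ z≤n) (ℤ.i≤j+i (+ z ℤ.* (Q ℤ.- 1ℤ)) Q) (begin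
        + length roughs ℤ.* ((1ℤ ℤ.+ s) ℤ.* (1ℤ ℤ.+ s))
          ≡⟨ cong (λ w → + length roughs ℤ.* (w ℤ.* w)) (weight≡ z) ⟨
        + length roughs ℤ.* (weight z ℤ.* weight z)
          ≤⟨ ∑-mono-filter (λ u → rough? z (u ++ t)) (words k) (λ u → square-nonNeg (sieve z 2z≤k (u ++ t)))
               (λ _ rough → cong₂ ℤ._*_ (sieve-rough rough) (sieve-rough rough)) ⟩
        ∑ (words k) (λ u → sieve z 2z≤k (u ++ t) ℤ.* sieve z 2z≤k (u ++ t))
          ≡⟨ secondMoment z 2z≤k {{ℕ.nonTrivial⇒nonZero q}} ⟩
        (Q ℤ.^ k ℤ.* Q) ℤ.* s
          ≡⟨ cong (λ p → (p ℤ.* Q) ℤ.* s) (pos-^ q k) ⟨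
        (+ (q ℕ.^ k) ℤ.* Q) ℤ.* s ∎)
      where
      open ℤ.≤-Reasoning
      s = Q ℤ.+ + z ℤ.* (Q ℤ.- 1ℤ)
      -- The closed form of the weight begins at 1, so z ≥ 1 is used here.
      weight≡ : ∀ z .{{_ : NonZero z}} → weight z ≡ 1ℤ ℤ.+ (Q ℤ.+ + z ℤ.* (Q ℤ.- 1ℤ))
      weight≡ (suc m) = weight-closed m
      1<q : 1 < q
      1<q = ℕ.nonTrivial⇒n>1 q
      0≤Q-1 : 0ℤ ℤ.≤ Q ℤ.- 1ℤ
      0≤Q-1 = ℤ.i≤j⇒0≤j-i (+≤+ (ℕ.<⇒≤ 1<q))
      0<s : 0ℤ ℤ.< s
      0<s = ℤ.+-mono-<-≤ {0ℤ} {Q} {0ℤ} (ℤ.+<+ (ℕ.<-trans (s≤s z≤n) 1<q))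
        (subst (ℤ._≤ + z ℤ.* (Q ℤ.- 1ℤ)) (ℤ.*-zeroʳ (+ z)) (ℤ.*-monoˡ-≤-nonNeg (+ z) 0≤Q-1))

-- The interval around A as a set of polynomials up to trailing zeros.

module Cardinality {q : ℕ} .{{q>1 : NonTrivial q}} (K : FiniteField q) (N : ℕ) (A : List (FiniteField.Carrier K))
                   (A-monic : Polynomials.𝓜 K N A) (h : ℕ) (h<N : suc h ≤ N) (z : ℕ) where
  open Roughness K
  open Liouville K
  open Monics K using (_+_; _*_; -_; _-_; module F)

  -- The coefficients of A in degrees h + 1 to N - 1, common to all F of the interval. The leading 1
  -- does not belong to the code.
  tail : Monic
  tail = drop (suc h) (code N A)

  open RoughInterval K (suc h) tail z

  length-tail : ∀ u → length u ≡ suc h → length (u ++ tail) ≡ N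
  length-tail u lu = begin
    length (u ++ tail)                     ≡⟨ length-++ u ⟩
    length u ℕ.+ length tail               ≡⟨ cong₂ ℕ._+_ lu (trans (length-drop (suc h) (code N A)) (cong (_∸ suc h) (length-code N A))) ⟩
    suc h ℕ.+ (N ∸ suc h)                  ≡⟨ ℕ.m+[n∸m]≡n h<N ⟩
    N                                      ∎
    where open ≡-Reasoning

  length-take-code : ∀ G → length (take (suc h) (code N G)) ≡ suc h
  length-take-code G = trans (length-take (suc h) (code N G))
    (trans (cong (suc h ℕ.⊓_) (length-code N G)) (ℕ.m≤n⇒m⊓n≡m h<N))

  coeff-suffix : ∀ u v w {n} → length u ≡ length v → length u ≤ n → coeff (u ++ w) n ≡ coeff (v ++ w) n
  coeff-suffix []      []      w _ _       = refl
  coeff-suffix (_ ∷ u) (_ ∷ v) w e (s≤s l) = coeff-suffix u v w (ℕ.suc-injective e) l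

  coeff-interval : ∀ u {n} → length u ≡ suc h → h < n → coeff (poly (u ++ tail)) n ≡ coeff A n
  coeff-interval u {n} lu h<n = begin
    coeff (poly (u ++ tail)) n                               ≡⟨ cong (λ G → coeff G n) (++-assoc u tail _) ⟩
    coeff (u ++ poly tail) n                                 ≡⟨ coeff-suffix u v (poly tail) (trans lu (sym (length-take-code A))) (ℕ.≤-trans (ℕ.≤-reflexive lu) h<n) ⟩
    coeff (v ++ poly tail) n                                 ≡⟨ cong (λ G → coeff G n) (++-assoc v tail _) ⟨
    coeff (poly (v ++ tail)) n                               ≡⟨ cong (λ f → coeff (poly f) n) (take++drop≡id (suc h) (code N A)) ⟩
    coeff (poly (code N A)) n                                ≡⟨ ≋⇒≈ (poly-code {N} {A} A-monic) n ⟩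
    coeff A n                                                ∎
    where
    open ≡-Reasoning
    v = take (suc h) (code N A)

  coeff-sub : ∀ G H n → coeff (G - H) n ≡ coeff G n F.+ (F.- coeff H n)
  coeff-sub G H n = trans (coeff-+ G (- H) n) (cong (coeff G n F.+_) (coeff-neg H n))

  drop-code : ∀ {G} → deg (G - A) ≤ h → drop (suc h) (code N G) ≡ tail
  drop-code {G} close = drop-applyUpTo (suc h) N λ i h<i →
    FieldProperties.x∙y⁻¹≈ε⇒x≈y _ _ (trans (sym (coeff-sub G A i)) (close i h<i))

  Sieved : Poly → Set
  Sieved G = 𝓜 N G × (deg (G - A) ≤ h) × (P⁻ G > z)

  list : List Poly
  list = map (λ u → poly (u ++ tail)) roughs

  1≤length : ∀ u → length u ≡ suc h → 1 ≤ length (u ++ tail)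
  1≤length u lu = ℕ.≤-trans (s≤s z≤n) (ℕ.≤-trans h<N (ℕ.≤-reflexive (sym (length-tail u lu))))

  sound : ∀ {G u} → u ∈ roughs → G ≈ poly (u ++ tail) → Sieved G
  sound {G} {u} u∈ e =
    𝓜-resp F≋G (subst (λ n → 𝓜 n (poly (u ++ tail))) (length-tail u lu) (𝓜-poly (u ++ tail))) ,
    (λ n h<n → trans (coeff-sub G A n) (trans (cong (F._+ (F.- coeff A n)) (trans (e n) (coeff-interval u lu h<n))) (F.-‿inverseʳ _))) ,
    rough⇒P⁻> {z} {u ++ tail} {G} F≋G (1≤length u lu) (proj₂ (∈-filter⁻ (λ u → rough? z (u ++ tail)) {xs = words (suc h)} u∈))
    where
    F≋G : poly (u ++ tail) ≋ G
    F≋G = ≋-sym (≈⇒≋ e)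
    lu = ∈-words⁻ (suc h) (proj₁ (∈-filter⁻ (λ u → rough? z (u ++ tail)) {xs = words (suc h)} u∈))

  complete : ∀ {G} → Sieved G → ∃ λ u → u ∈ roughs × poly (u ++ tail) ≋ G
  complete {G} (monic , close , smooth) = u , ∈-filter⁺ (λ u → rough? z (u ++ tail)) (∈-words u lu)
      (P⁻>⇒rough {z} {u ++ tail} {G} F≋G (1≤length u lu) smooth) , F≋G
    where
    u = take (suc h) (code N G)
    lu = length-take-code G
    F≋G : poly (u ++ tail) ≋ G
    F≋G = ≋-trans (≈⇒≋ λ n → cong (λ f → coeff (poly f) n) (trans (cong (u ++_) (sym (drop-code {G} close)))
            (take++drop≡id (suc h) (code N G)))) (poly-code monic)

  -- Every polynomial of the interval has exactly one code `u ++ tail`, so counting classes of `_≈_`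
  -- amounts to counting the words u.
  cardinality : HasCardinality polySetoid Sieved (length roughs)
  cardinality = list
    , SetoidUnique.map⁺ (setoid Monic) polySetoid
        (λ {u} {v} e → ++-cancelʳ tail u v (poly-injective (≈⇒≋ e)))
        (Unique.filter⁺ (λ u → rough? z (u ++ tail)) (words! (suc h)))
    , (λ G → mk⇔
        (λ G∈ → let u , u∈ , e = SetoidMembership.∈-map⁻ (setoid Monic) polySetoid {v = G} G∈ in sound {G} u∈ e)
        (λ s → let u , u∈ , e = complete {G} s in
          SetoidMembership.∈-resp-≈ polySetoid {x = poly (u ++ tail)} {G} (≋⇒≈ e)
            (SetoidMembership.∈-map⁺ (setoid Monic) polySetoid (λ { refl _ → refl }) u∈)))
    , length-map (λ u → poly (u ++ tail)) roughs

lemma2p7 : (q : ℕ) .{{_ : NonTrivial q}} → IsPrimePower q → (K : FiniteField q) →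
    let open Polynomials K in
    (N : ℕ) → 1 ≤ N → (A : Poly) → 𝓜 N A →
    (h : ℕ) → h ≤ N ∸ 1 → (z : ℕ) .{{_ : NonZero z}} → 2 ℕ.* z ≤ suc h →
    ∃ λ c → HasCardinality polySetoid (λ F → 𝓜 N F × (deg (F - A) ≤ h) × (P⁻ F > z)) c
    × (+ c / 1) ℚ.≤ (+ (q ℕ.^ suc h) / 1) ÷ (z ·[1-1/ q ])
lemma2p7 q _ K N 1≤N A A-monic h h≤N-1 z 2z≤h+1 =
  length roughs , C.cardinality , density-bound (length roughs) (q ℕ.^ suc h) z q (rough-count z+z≤h+1)
  where
  -- The subtraction in `N ∸ 1` truncates, so N ≥ 1 is used to pass from h ≤ N ∸ 1 to h < N.
  h<N : suc h ≤ N
  h<N = ℕ.≤-trans (s≤s h≤N-1) (ℕ.≤-reflexive (ℕ.m+[n∸m]≡n 1≤N))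
  module C = Cardinality K N A A-monic h h<N z
  open RoughInterval K (suc h) C.tail z
  z+z≤h+1 : z ℕ.+ z ≤ suc h
  z+z≤h+1 = ℕ.≤-trans (ℕ.≤-reflexive (cong (z ℕ.+_) (sym (ℕ.+-identityʳ z)))) 2z≤h+1
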